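{- Let $r\geq 5$ be an integer and let $n$ be an integer with $n>6r\binom{4r}{r-1}$. Then for every coloring of the edges of $K_n^{r}$ with $r-1$ colors, there is a monochromatic Hamiltonian Berge-cycle in $K_n^{r}$.
   Context: $K_n^{r}$ denotes the complete $r$-uniform hypergraph on $n$ vertices (its edges are all $r$-element subsets of an $n$-element vertex set). An $r$-uniform Berge-cycle of length $n$ consists of a sequence of distinct vertices $v_1,\dots,v_n$ (the core sequence) and distinct edges $e_1,\dots,e_n$ such that $\{v_i,v_{i+1}\}\subseteq e_i$ for each $i$, indices taken modulo $n$. A Berge-cycle of length $n$ in a hypergraph with $n$ vertices is called Hamiltonian. It is monochromatic if all of its edges $e_1,\dots,e_n$ have the same color. -}

module Defs where

open import Data.Nat using (ℕ; zero; suc; _∸_)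
open import Data.Fin using (Fin; zero; suc; toℕ; fromℕ; inject₁)
open import Data.Fin.Subset using (Subset; _∈_; ∣_∣)
open import Data.Product using (Σ; _×_; _,_)
open import Relation.Binary.PropositionalEquality using (_≡_)
open import Function.Definitions using (Injective)

IsEdge : (n r : ℕ) → Subset n → Set
IsEdge n r e = ∣ e ∣ ≡ r

-- An edge colouring of K_n^r with k colours: assigns a colour to every subset;
-- only the values on r-element subsets (the edges) are ever used.
Colouring : (n k : ℕ) → Set
Colouring n k = Subset n → Fin k

next : {m : ℕ} → Fin (suc m) → Fin (suc m)
next {zero} zero = zero
next {suc m} zero = suc zero
next {suc m} (suc i) with next {m} i
... | zero = zero
... | suc j = suc (suc j)

record MonoHamBergeCycle (m r k : ℕ) (χ : Colouring (suc m) k) : Set where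
  field
    colour   : Fin k
    vertex   : Fin (suc m) → Fin (suc m)
    edge     : Fin (suc m) → Subset (suc m)
    vertex-inj : Injective _≡_ _≡_ vertex
    edge-inj   : Injective _≡_ _≡_ edge
    edge-size  : ∀ i → IsEdge (suc m) r (edge i)
    contains-v : ∀ i → vertex i ∈ edge i
    contains-next : ∀ i → vertex (next i) ∈ edge i
    mono       : ∀ i → χ (edge i) ≡ colour

{-# OPTIONS --safe #-}

-- Call a pair of vertices light in a colour if fewer than r + 2 edges of that colour contain it. By
-- Hall's theorem a Hamiltonian cycle of pairs that are not light in some colour is the core of a
-- monochromatic Berge-cycle, and by Ore's exchange argument, if there is no such cycle, the light
-- pairs contain a nonempty graph in which adjacent vertices have degree sum at least n - 1.
-- A set W of r - 1 vertices containing a light pair of every colour is impossible, since few of the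
-- edges W ∪ {z} could have any given colour; likewise for r vertices of which two range over long
-- lists. Chaining light pairs through the colours in decreasing order of κ, the least number of
-- non-neighbours of a vertex, produces such a configuration unless every colour but one has a star:
-- a vertex light with all but boundedly many vertices.
-- Then, to build a cycle in colour i, an edge of colour i formed by stars of the other colours and
-- two further vertices u, v is reserved for the pair {u , v}. If this still gives no Hamiltonian
-- cycle, colour i has a star e_i such that few edges through e_i, some stars of the other colours
-- and one more vertex have colour i. Taking e_i for all i, no colour is left for {e_1 , … , e_(r-1) , z}.
module Submission where

open import Defs
open import Algebra.Properties.CommutativeSemigroup using (x∙yz≈y∙xz)
open import Data.Bool using (true; false)
import Data.Bool.Properties as Bool
open import Data.Empty using (⊥; ⊥-elim)
open import Data.Fin using (Fin; zero; suc; toℕ; fromℕ; inject₁)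
import Data.Fin.Properties as Fin
open import Data.Fin.Relation.Unary.Top using (view; ‵fromℕ; ‵inject₁)
open import Data.Fin.Subset using (Subset; inside; outside; _∪_; ⁅_⁆; ∣_∣)
  renaming (_∈_ to _∈ˢ_; _∉_ to _∉ˢ_; _⊆_ to _⊆ˢ_; ⊥ to ∅)
open import Data.Fin.Subset.Properties
  using (_∈?_; anySubset?; drop-there; p⊆p∪q; q⊆p∪q; x∈p∪q⁻; x∈⁅x⁆; x∈⁅y⁆⇒x≡y; ∪-assoc; ∪-comm;
         p⊂q⇒∣p∣<∣q∣; ∣⊥∣≡0; ∉⊥)
open import Data.List as List
  using (List; []; _∷_; _++_; _∷ʳ_; length; map; filter; foldr; take; lookup; reverse; allFin;
         cartesianProduct; initLast; _∷ʳ′_)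
open import Data.List.Properties
  using (length-map; length-take; length-++; length-tabulate; map-tabulate; ++-assoc; ++-identityʳ;
         ∷ʳ-injective; ∷ʳ-injectiveʳ; unfold-reverse; reverse-++)
import Data.List.Membership.DecPropositional as DecMembership
open import Data.List.Membership.Propositional using (_∈_; _∉_; find; lose)
open import Data.List.Membership.Propositional.Properties
  using (∈-∃++; ∈-filter⁺; ∈-filter⁻; ∈-allFin; ∈-map⁻; ∈-map⁺; ∈-++⁺ˡ; ∈-++⁺ʳ; ∈-++⁻; ∈-lookup;
         ∈-cartesianProduct⁺)
open import Data.List.Relation.Binary.Permutation.Propositional
  using (_↭_; prep; swap; ↭-refl; ↭-sym; ↭-trans; ↭-reflexive; ↭⇒↭ₛ; module PermutationReasoning)
open import Data.List.Relation.Binary.Permutation.Propositional.Properties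
  using (↭-length; shift; ++-comm; ↭-reverse; All-resp-↭; ∈-resp-↭; ++⁺ˡ)
import Data.List.Relation.Binary.Permutation.Setoid.Properties as ↭ₛ
open import Data.List.Relation.Unary.All as All using (All; []; _∷_; all?)
import Data.List.Relation.Unary.All.Properties as All
open import Data.List.Relation.Unary.AllPairs as AllPairs using ([]; _∷_)
open import Data.List.Relation.Unary.Any using (Any; here; there; any?)
open import Data.List.Relation.Unary.Unique.Propositional using (Unique)
import Data.List.Relation.Unary.Unique.Propositional.Properties as Unique
open import Data.Nat
open import Data.Nat.Combinatorics using (_C_; nCk+nC[k+1]≡[n+1]C[k+1])
open import Data.Nat.Properties
open import Data.Nat.Tactic.RingSolver using (solve-∀)
open import Data.Product using (∃-syntax; Σ-syntax; _×_; _,_; proj₁; proj₂) renaming (swap to ×-swap)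
open import Data.Sum as Sum using (_⊎_; inj₁; inj₂)
open import Data.Vec using ([]; _∷_; here; there)
open import Data.Vec.Properties using (∷-injectiveʳ; ≡-dec)
open import Function using (_∘_; id)
open import Level using (Level; 0ℓ)
open import Relation.Binary using (DecidableEquality)
open import Relation.Binary.PropositionalEquality
  using (_≡_; _≢_; refl; sym; trans; cong; cong₂; subst; setoid; module ≡-Reasoning)
open import Relation.Nullary using (¬_; Dec; yes; no; ¬?; _×-dec_; _⊎-dec_; _→-dec_)
open import Relation.Nullary.Decidable using (decidable-stable)
open import Relation.Unary using (Pred; Decidable)

-- The number r + 2 has two sources. An edge has r vertices, so it can serve at most r positions of
-- a cyclic order, and r candidates per position then give Hall's condition; the 2 pays for the
-- reserved edges of the two neighbouring positions, which are struck from the candidates. Apart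
-- from u and v, the edge reserved for {u , v} lies in a set `Q`, and this makes it useless for
-- every other pair, provided that no two vertices of `Q` are consecutive. So pairs inside `Q` are
-- forbidden, along with light pairs that have no reserved edge. The degree conditions bite only if
-- `Q` is small. Yet the final contradiction needs e_j in the set `Q` of every other colour i,
-- although e_j is not known when that set is chosen. `Q` therefore takes all stars of the other
-- colours. This is affordable for colours with at most R = 2(r-1)(r+2) stars, and the argument with
-- two long lists shows that at most one colour has more. The e of that colour is found first, and
-- alone represents its colour in the sets `Q` of the others.

module Counting where

  private
    variable
      A B : Set
      P Q R : Pred A 0ℓ
      xs ys : List A

  opaque
    # : {P : Pred A 0ℓ} → Decidable P → List A → ℕ
    # P? xs = length (filter P? xs)

  opaque
    unfolding #

    #-mono : (P? : Decidable P) (Q? : Decidable Q) →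
      ∀ xs → (∀ {x} → x ∈ xs → P x → Q x) → # P? xs ≤ # Q? xs
    #-mono P? Q? [] f = z≤n
    #-mono P? Q? (x ∷ xs) f with ih ← #-mono P? Q? xs (f ∘ there) | P? x | Q? x
    ... | yes p | yes q = s≤s ih
    ... | yes p | no ¬q = ⊥-elim (¬q (f (here refl) p))
    ... | no ¬p | yes q = m≤n⇒m≤1+n ih
    ... | no ¬p | no ¬q = ih

    #-strict : (P? : Decidable P) (Q? : Decidable Q) → ∀ {xs y} → (∀ {x} → P x → Q x) →
      y ∈ xs → Q y → ¬ P y → # P? xs < # Q? xs
    #-strict P? Q? {x ∷ xs} f (here refl) q ¬p with P? x | Q? x
    ... | yes p | _ = ⊥-elim (¬p p)
    ... | no _ | no ¬q = ⊥-elim (¬q q)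
    ... | no _ | yes _ = s≤s (#-mono P? Q? xs (λ _ → f))
    #-strict P? Q? {x ∷ xs} f (there y∈) q ¬p
      with ih ← #-strict P? Q? f y∈ q ¬p | P? x | Q? x
    ... | yes p | yes q′ = s≤s ih
    ... | yes p | no ¬q = ⊥-elim (¬q (f p))
    ... | no _ | yes _ = m≤n⇒m≤1+n ih
    ... | no _ | no _ = ih

    #-∪ : (P? : Decidable P) (Q? : Decidable Q) (R? : Decidable R) →
      ∀ xs → (∀ {x} → x ∈ xs → P x → Q x ⊎ R x) → # P? xs ≤ # Q? xs + # R? xs
    #-∪ P? Q? R? [] f = z≤n
    #-∪ P? Q? R? (x ∷ xs) f with ih ← #-∪ P? Q? R? xs (f ∘ there) | P? x | Q? x | R? x
    ... | yes p | yes q | yes r = s≤s (≤-trans ih (+-monoʳ-≤ (# Q? xs) (n≤1+n _)))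
    ... | yes p | yes q | no _ = s≤s ih
    ... | yes p | no _ | yes r rewrite +-suc (# Q? xs) (# R? xs) = s≤s ih
    ... | no _ | yes q | yes r = m≤n⇒m≤1+n (≤-trans ih (+-monoʳ-≤ (# Q? xs) (n≤1+n _)))
    ... | no _ | yes q | no _ = m≤n⇒m≤1+n ih
    ... | no _ | no _ | yes r = ≤-trans ih (+-monoʳ-≤ (# Q? xs) (n≤1+n _))
    ... | no _ | no _ | no _ = ih
    ... | yes p | no ¬q | no ¬r with f (here refl) p
    ...   | inj₁ q = ⊥-elim (¬q q)
    ...   | inj₂ r = ⊥-elim (¬r r)

    #-complement : (P? : Decidable P) → ∀ xs → # P? xs + # (¬? ∘ P?) xs ≡ length xs
    #-complement P? [] = refl
    #-complement P? (x ∷ xs) with P? x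
    ... | yes _ = cong suc (#-complement P? xs)
    ... | no _ = trans (+-suc _ _) (cong suc (#-complement P? xs))

    #-all : (P? : Decidable P) → ∀ xs → (∀ {x} → x ∈ xs → P x) → # P? xs ≡ length xs
    #-all P? [] f = refl
    #-all P? (x ∷ xs) f with P? x
    ... | yes _ = cong suc (#-all P? xs (f ∘ there))
    ... | no ¬p = ⊥-elim (¬p (f (here refl)))

    #-none : (P? : Decidable P) → ∀ xs → (∀ {x} → x ∈ xs → ¬ P x) → # P? xs ≡ 0
    #-none P? [] f = refl
    #-none P? (x ∷ xs) f with P? x
    ... | no _ = #-none P? xs (f ∘ there)
    ... | yes p = ⊥-elim (f (here refl) p)

    #-++ : (P? : Decidable P) → ∀ xs ys → # P? (xs ++ ys) ≡ # P? xs + # P? ys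
    #-++ P? [] ys = refl
    #-++ P? (x ∷ xs) ys with P? x
    ... | yes _ = cong suc (#-++ P? xs ys)
    ... | no _ = #-++ P? xs ys

    #-↭ : (P? : Decidable P) → xs ↭ ys → # P? xs ≡ # P? ys
    #-↭ P? _↭_.refl = refl
    #-↭ P? (prep x p) with P? x
    ... | yes _ = cong suc (#-↭ P? p)
    ... | no _ = #-↭ P? p
    #-↭ P? (swap x y p) with P? x in ex | P? y in ey
    ... | yes _ | yes _ rewrite ex | ey = cong 2+ (#-↭ P? p)
    ... | yes _ | no _ rewrite ex | ey = cong suc (#-↭ P? p)
    ... | no _ | yes _ rewrite ex | ey = cong suc (#-↭ P? p)
    ... | no _ | no _ rewrite ex | ey = #-↭ P? p
    #-↭ P? (_↭_.trans p q) = trans (#-↭ P? p) (#-↭ P? q)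

    #-map : (f : B → A) (P? : Decidable P) → ∀ xs → # P? (map f xs) ≡ # (P? ∘ f) xs
    #-map f P? [] = refl
    #-map f P? (x ∷ xs) with P? (f x)
    ... | yes _ = cong suc (#-map f P? xs)
    ... | no _ = #-map f P? xs

    #-exists : (P? : Decidable P) → ∀ xs → 0 < # P? xs → ∃[ x ] x ∈ xs × P x
    #-exists P? (x ∷ xs) pos with P? x
    ... | yes p = x , here refl , p
    ... | no _ with y , y∈ , p ← #-exists P? xs pos = y , there y∈ , p

    #-exists-¬ : (P? : Decidable P) → ∀ xs → # P? xs < length xs → ∃[ x ] x ∈ xs × ¬ P x
    #-exists-¬ P? xs lt = #-exists (¬? ∘ P?) xs
      (+-cancelˡ-< (# P? xs) 0 _ (≤-trans (s≤s (≤-reflexive (+-identityʳ _)))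
        (≤-trans lt (≤-reflexive (sym (#-complement P? xs))))))

    unique-⊆-length : Unique xs → (∀ {x} → x ∈ xs → x ∈ ys) → length xs ≤ length ys
    unique-⊆-length {xs = []} _ _ = z≤n
    unique-⊆-length {xs = x ∷ xs} (x≢ ∷ u) sub with ∈-∃++ (sub (here refl))
    ... | as , bs , refl = begin
      suc (length xs)         ≤⟨ s≤s (unique-⊆-length u sub′) ⟩
      suc (length (as ++ bs)) ≡⟨ cong suc (length-++ as) ⟩
      suc (length as + length bs) ≡⟨ sym (+-suc _ _) ⟩
      length as + suc (length bs) ≡⟨ sym (length-++ as) ⟩
      length (as ++ x ∷ bs)   ∎
      where
      open ≤-Reasoning
      sub′ : ∀ {y} → y ∈ xs → y ∈ as ++ bs
      sub′ {y} y∈ with ∈-++⁻ as (sub (there y∈))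
      ... | inj₁ a = ∈-++⁺ˡ a
      ... | inj₂ (here refl) = ⊥-elim (All.lookup x≢ y∈ refl)
      ... | inj₂ (there b) = ∈-++⁺ʳ as b

    unique-⊆-# : (P? : Decidable P) → Unique xs → (∀ {x} → x ∈ xs → x ∈ ys × P x) →
      length xs ≤ # P? ys
    unique-⊆-# P? u f = unique-⊆-length u (λ x∈ → ∈-filter⁺ P? (proj₁ (f x∈)) (proj₂ (f x∈)))

    #-⊆ : (P? : Decidable P) → Unique xs → (∀ {x} → x ∈ xs → x ∈ ys) → # P? xs ≤ # P? ys
    #-⊆ {xs = xs} P? u f = unique-⊆-# P? (Unique.filter⁺ P? u)
      λ x∈ → let x∈xs , p = ∈-filter⁻ P? {xs = xs} x∈ in f x∈xs , p

    unique-map : (f : A → B) → (∀ {x y} → x ∈ xs → y ∈ xs → f x ≡ f y → x ≡ y) →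
      Unique xs → Unique (map f xs)
    unique-map {xs = []} f inj u = []
    unique-map {xs = x ∷ xs} f inj (x≢ ∷ u) =
      All.tabulate (λ y∈ eq → let y , y∈xs , y≡ = ∈-map⁻ f y∈ in
        All.lookup x≢ y∈xs (inj (here refl) (there y∈xs) (trans eq y≡)))
      ∷ unique-map f (λ x∈ y∈ → inj (there x∈) (there y∈)) u

    #-inj : (P? : Decidable P) (Q? : Decidable Q) (f : A → B) → ∀ {xs ys} → Unique xs →
      (∀ {x y} → P x → P y → f x ≡ f y → x ≡ y) →
      (∀ {x} → x ∈ xs → P x → f x ∈ ys × Q (f x)) → # P? xs ≤ # Q? ys
    #-inj {P = P} {Q = Q} P? Q? f {xs} {ys} u inj h = subst (_≤ # Q? ys) (length-map f (filter P? xs))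
      (unique-⊆-# Q? (unique-map f (λ x∈ y∈ → inj (holds x∈) (holds y∈)) (Unique.filter⁺ P? u)) λ {y} y∈ →
        let x , x∈ , y≡ = ∈-map⁻ f y∈
            fx∈ , q = h (proj₁ (∈-filter⁻ P? {xs = xs} x∈)) (holds x∈)
        in subst (_∈ ys) (sym y≡) fx∈ , subst Q (sym y≡) q)
      where
      holds : ∀ {x} → x ∈ filter P? xs → P x
      holds x∈ = proj₂ (∈-filter⁻ P? {xs = xs} x∈)

    #-filter : (P? : Decidable P) → ∀ xs → # P? xs ≡ length (filter P? xs)
    #-filter P? xs = refl

    subfamily : (P? : Decidable P) → ∀ {xs} N → Unique xs → N ≤ # P? xs →
      ∃[ zs ] length zs ≡ N × Unique zs × (∀ {z} → z ∈ zs → z ∈ xs × P z)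
    subfamily P? {xs} N u le = take N (filter P? xs) ,
      trans (length-take N _) (m≤n⇒m⊓n≡m le) ,
      Unique.take⁺ N (Unique.filter⁺ P? u) ,
      λ z∈ → ∈-filter⁻ P? (∈-take N _ z∈)
      where
      ∈-take : ∀ {z : A} N xs → z ∈ take N xs → z ∈ xs
      ∈-take (suc N) (x ∷ xs) (here p) = here p
      ∈-take (suc N) (x ∷ xs) (there p) = there (∈-take N xs p)

  module _ {A B : Set} {R : A → B → Set} (R? : ∀ x y → Dec (R x y)) where

    private
      degrees : List A → List B → ℕ
      degrees [] ys = 0
      degrees (x ∷ xs) ys = # (R? x) ys + degrees xs ys

      opaque
       unfolding #
       degrees-∷ : ∀ xs y ys → degrees xs (y ∷ ys) ≡ # (λ x → R? x y) xs + degrees xs ys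
       degrees-∷ [] y ys = refl
       degrees-∷ (x ∷ xs) y ys with ih ← degrees-∷ xs y ys | R? x y
       ... | yes _ = cong suc (trans (cong (# (R? x) ys +_) ih)
         (x∙yz≈y∙xz +-commutativeSemigroup (# (R? x) ys) (# (λ x → R? x y) xs) (degrees xs ys)))
       ... | no _ = trans (cong (# (R? x) ys +_) ih)
         (x∙yz≈y∙xz +-commutativeSemigroup (# (R? x) ys) (# (λ x → R? x y) xs) (degrees xs ys))

      upper : ∀ a xs ys → (∀ {x} → x ∈ xs → # (R? x) ys ≤ a) → degrees xs ys ≤ length xs * a
      upper a [] ys h = z≤n
      upper a (x ∷ xs) ys h = +-mono-≤ (h (here refl)) (upper a xs ys (h ∘ there))

      lower : ∀ b xs ys → (∀ {y} → y ∈ ys → b ≤ # (λ x → R? x y) xs) → length ys * b ≤ degrees xs ys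
      lower b xs [] h = z≤n
      lower b xs (y ∷ ys) h rewrite degrees-∷ xs y ys = +-mono-≤ (h (here refl)) (lower b xs ys (h ∘ there))

    -- The related pairs are counted twice: summed over `xs` they are bounded from above, summed
    -- over `ys` from below.
    double-count : ∀ a b xs ys → (∀ {x} → x ∈ xs → # (R? x) ys ≤ a) →
      (∀ {y} → y ∈ ys → b ≤ # (λ x → R? x y) xs) → length ys * b ≤ length xs * a
    double-count a b xs ys h g = ≤-trans (lower b xs ys g) (upper a xs ys h)

  length-allFin : ∀ n → length (allFin n) ≡ n
  length-allFin n = length-tabulate id

  opaque
    unfolding #

    #-⋃ : {P : Pred A 0ℓ} (P? : Decidable P) {I : Set} {Q : I → Pred A 0ℓ} (Q? : ∀ i → Decidable (Q i)) →
      ∀ is N xs → (∀ {i} → i ∈ is → # (Q? i) xs ≤ N) →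
      (∀ {x} → x ∈ xs → P x → ∃[ i ] i ∈ is × Q i x) → # P? xs ≤ length is * N
    #-⋃ P? {Q = Q} Q? is N xs bound cover with double-count (λ i x → Q? i x) N 1 is (filter P? xs)
        (λ i∈ → ≤-trans (filtered _) (bound i∈))
        (λ x∈ → let x∈xs , p = ∈-filter⁻ P? {xs = xs} x∈
                    i , i∈ , q = cover x∈xs p
                in one i∈ q)
      where
      filtered : ∀ i → # (Q? i) (filter P? xs) ≤ # (Q? i) xs
      filtered i = go xs
        where
        go : ∀ zs → # (Q? i) (filter P? zs) ≤ # (Q? i) zs
        go [] = z≤n
        go (z ∷ zs) with P? z
        go (z ∷ zs) | yes _ with Q? i z
        ... | yes _ = s≤s (go zs)
        ... | no _ = go zs
        go (z ∷ zs) | no _ with Q? i z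
        ... | yes _ = m≤n⇒m≤1+n (go zs)
        ... | no _ = go zs
      one : ∀ {i x} → i ∈ is → Q i x → 1 ≤ # (λ j → Q? j x) is
      one {i} {x} i∈ q = unique-⊆-# (λ j → Q? j x) ([] ∷ []) λ { (here refl) → i∈ , q }
    ... | le = subst (_≤ length is * N) (*-identityʳ _) le

open Counting

-- Systems of distinct representatives

module Representatives {A B : Set} (_≟A_ : DecidableEquality A) (_≟B_ : DecidableEquality B)
  (candidates : A → List B) (d : ℕ) (0<d : 0 < d) where

  open DecMembership _≟B_ using () renaming (_∈?_ to _∈ᴮ?_)

  record Matching (L : List A) : Set where
    field
      rep       : A → B
      candidate : ∀ {a} → a ∈ L → rep a ∈ candidates a
      injective : ∀ {a a′} → a ∈ L → a′ ∈ L → rep a ≡ rep a′ → a ≡ a′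

  _[_↦_] : (A → B) → A → B → A → B
  (f [ a ↦ b ]) x with x ≟A a
  ... | yes _ = b
  ... | no _ = f x

  ↦-other : ∀ f a b {x} → x ≢ a → (f [ a ↦ b ]) x ≡ f x
  ↦-other f a b {x} x≢a with x ≟A a
  ... | yes p = ⊥-elim (x≢a p)
  ... | no _ = refl

  -- Hall's condition is not assumed directly. It follows by double counting when every list has at
  -- least `d` entries and every `b` occurs in at most `d` lists.
  module Augment (a₀ : A) (L : List A) (unique : Unique (a₀ ∷ L))
    (many : ∀ {a} → a ∈ a₀ ∷ L → Unique (candidates a) × d ≤ length (candidates a))
    (few : ∀ b → # (λ a → b ∈ᴮ? candidates a) (a₀ ∷ L) ≤ d)
    (M : Matching L) where

    open Matching M renaming (rep to f)

    -- The outcome of switching M along an alternating path from a₀ to b inside R.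
    record Shifted (R : List A) (b : A) : Set where
      field
        g      : A → B
        cand   : ∀ {a} → a ∈ a₀ ∷ L → a ≢ b → g a ∈ candidates a
        inj    : ∀ {a a′} → a ∈ a₀ ∷ L → a′ ∈ a₀ ∷ L → a ≢ b → a′ ≢ b → g a ≡ g a′ → a ≡ a′
        image  : ∀ {a} → a ∈ a₀ ∷ L → a ≢ b → g a ∈ map f L
        -- Outside `R` every value of `M` still has its old owner, so in `switch` a value `f b′`
        -- with `b′ ∉ R` is taken from `b′` alone.
        agrees : ∀ {a} → a ∉ R → g a ≡ f a

    shifted-mono : ∀ {R b} a → Shifted R b → Shifted (a ∷ R) b
    shifted-mono a s = record
      { g = g ; cand = cand ; inj = inj ; image = image ; agrees = λ a∉ → agrees (a∉ ∘ there) }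
      where open Shifted s

    start : Shifted (a₀ ∷ []) a₀
    start = record
      { g = f
      ; cand = λ a∈ a≢ → candidate (tail a∈ a≢)
      ; inj = λ a∈ a′∈ a≢ a′≢ → injective (tail a∈ a≢) (tail a′∈ a′≢)
      ; image = λ a∈ a≢ → ∈-map⁺ f (tail a∈ a≢)
      ; agrees = λ _ → refl }
      where
      tail : ∀ {a} → a ∈ a₀ ∷ L → a ≢ a₀ → a ∈ L
      tail (here p) a≢ = ⊥-elim (a≢ p)
      tail (there p) _ = p

    extend : ∀ {R b e} → Shifted R b → b ∈ a₀ ∷ L → e ∈ candidates b → e ∉ map f L →
      Matching (a₀ ∷ L)
    extend {R} {b} {e} s b∈ e∈ e∉ = record
      { rep = g [ b ↦ e ] ; candidate = cand′ ; injective = inj′ }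
      where
      open Shifted s
      cand′ : ∀ {a} → a ∈ a₀ ∷ L → (g [ b ↦ e ]) a ∈ candidates a
      cand′ {a} a∈ with a ≟A b
      ... | yes refl = e∈
      ... | no a≢ = cand a∈ a≢
      inj′ : ∀ {a a′} → a ∈ a₀ ∷ L → a′ ∈ a₀ ∷ L →
        (g [ b ↦ e ]) a ≡ (g [ b ↦ e ]) a′ → a ≡ a′
      inj′ {a} {a′} a∈ a′∈ eq with a ≟A b | a′ ≟A b
      ... | yes p | yes q = trans p (sym q)
      ... | yes _ | no a′≢ = ⊥-elim (e∉ (subst (_∈ map f L) (sym eq) (image a′∈ a′≢)))
      ... | no a≢ | yes _ = ⊥-elim (e∉ (subst (_∈ map f L) eq (image a∈ a≢)))
      ... | no a≢ | no a′≢ = inj a∈ a′∈ a≢ a′≢ eq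

    -- `b′` hands its value to `b`, and the vacancy moves from `b` to `b′`.
    switch : ∀ {R b b′} → Shifted R b → b ∈ a₀ ∷ L → b ∈ R → b′ ∈ L → b′ ∉ R →
      f b′ ∈ candidates b → Shifted (b′ ∷ R) b′
    switch {R} {b} {b′} s b∈ b∈R b′∈ b′∉ e∈ = record
      { g = g [ b ↦ f b′ ] ; cand = cand′ ; inj = inj′ ; image = image′ ; agrees = agrees′ }
      where
      open Shifted s
      b′≢b : b′ ≢ b
      b′≢b refl = b′∉ b∈R
      clash : ∀ {a} → a ∈ a₀ ∷ L → a ≢ b → a ≢ b′ → g a ≡ f b′ → ⊥
      clash a∈ a≢ a≢′ eq = a≢′ (inj a∈ (there b′∈) a≢ b′≢b (trans eq (sym (agrees b′∉))))
      cand′ : ∀ {a} → a ∈ a₀ ∷ L → a ≢ b′ → (g [ b ↦ f b′ ]) a ∈ candidates a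
      cand′ {a} a∈ _ with a ≟A b
      ... | yes refl = e∈
      ... | no a≢ = cand a∈ a≢
      inj′ : ∀ {a a′} → a ∈ a₀ ∷ L → a′ ∈ a₀ ∷ L → a ≢ b′ → a′ ≢ b′ →
        (g [ b ↦ f b′ ]) a ≡ (g [ b ↦ f b′ ]) a′ → a ≡ a′
      inj′ {a} {a′} a∈ a′∈ a≢′ a′≢′ eq with a ≟A b | a′ ≟A b
      ... | yes p | yes q = trans p (sym q)
      ... | yes _ | no a′≢ = ⊥-elim (clash a′∈ a′≢ a′≢′ (sym eq))
      ... | no a≢ | yes _ = ⊥-elim (clash a∈ a≢ a≢′ eq)
      ... | no a≢ | no a′≢ = inj a∈ a′∈ a≢ a′≢ eq
      image′ : ∀ {a} → a ∈ a₀ ∷ L → a ≢ b′ → (g [ b ↦ f b′ ]) a ∈ map f L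
      image′ {a} a∈ _ with a ≟A b
      ... | yes _ = ∈-map⁺ f b′∈
      ... | no a≢ = image a∈ a≢
      agrees′ : ∀ {a} → a ∉ b′ ∷ R → (g [ b ↦ f b′ ]) a ≡ f a
      agrees′ {a} a∉ = trans (↦-other g b (f b′) λ { refl → a∉ (there b∈R) }) (agrees (a∉ ∘ there))

    ∷⁺ : ∀ {R} → (∀ {a} → a ∈ R → a ∈ L) → ∀ {a} → a ∈ a₀ ∷ R → a ∈ a₀ ∷ L
    ∷⁺ R⊆L (here p) = here p
    ∷⁺ R⊆L (there p) = there (R⊆L p)

    -- `R` collects elements of `L` reachable from `a₀` by alternating paths. A candidate of a
    -- reached element outside `map f R` is either free, which ends the search, or owned by some
    -- `b′` that joins `R`. Without such a candidate, the lists of the `length R + 1` elements of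
    -- `a₀ ∷ R` draw on only `length R` values, against the double count.
    grow : ∀ N R → Unique (a₀ ∷ R) → (∀ {a} → a ∈ R → a ∈ L) → length L ≤ length R + N →
      (∀ {b} → b ∈ a₀ ∷ R → Shifted (a₀ ∷ R) b) → Matching (a₀ ∷ L)
    grow N R uR R⊆L fuel shifts
      with any? (λ b → any? (λ e → ¬? (e ∈ᴮ? map f R)) (candidates b)) (a₀ ∷ R)
    ... | yes found
      with b , b∈ , found′ ← find found
      with e , e∈ , e∉R ← find found′
      with e ∈ᴮ? map f L
    ...   | no e∉L = extend (shifts b∈) (∷⁺ R⊆L b∈) e∈ e∉L
    ...   | yes e∈L with b′ , b′∈ , refl ← ∈-map⁻ f e∈L = continue N fuel
      where
      b′∉R : b′ ∉ R
      b′∉R p = e∉R (∈-map⁺ f p)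
      b′∉ : b′ ∉ a₀ ∷ R
      b′∉ (here refl) = Unique.Unique[x∷xs]⇒x∉xs unique b′∈
      b′∉ (there p) = b′∉R p
      uR′ : Unique (b′ ∷ R)
      uR′ = All.tabulate (λ x∈ eq → b′∉R (subst (_∈ R) (sym eq) x∈)) ∷ AllPairs.tail uR
      uR″ : Unique (a₀ ∷ b′ ∷ R)
      uR″ = ((λ eq → b′∉ (here (sym eq))) ∷ AllPairs.head uR) ∷ uR′
      R′⊆L : ∀ {a} → a ∈ b′ ∷ R → a ∈ L
      R′⊆L (here refl) = b′∈
      R′⊆L (there p) = R⊆L p
      swap-head : ∀ {b} → Shifted (b′ ∷ a₀ ∷ R) b → Shifted (a₀ ∷ b′ ∷ R) b
      swap-head s = record { g = g ; cand = cand ; inj = inj ; image = image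
        ; agrees = λ a∉ → agrees λ { (here p) → a∉ (there (here p)) ; (there (here p)) → a∉ (here p)
                                   ; (there (there p)) → a∉ (there (there p)) } }
        where open Shifted s
      shifts′ : ∀ {c} → c ∈ a₀ ∷ b′ ∷ R → Shifted (a₀ ∷ b′ ∷ R) c
      shifts′ (here p) = swap-head (shifted-mono b′ (shifts (here p)))
      shifts′ (there (here refl)) = swap-head (switch (shifts b∈) (∷⁺ R⊆L b∈) b∈ b′∈ b′∉ e∈)
      shifts′ (there (there p)) = swap-head (shifted-mono b′ (shifts (there p)))
      continue : ∀ N → length L ≤ length R + N → Matching (a₀ ∷ L)
      continue zero fuel = ⊥-elim (<-irrefl refl (≤-trans (unique-⊆-length uR′ R′⊆L)
        (≤-trans fuel (≤-reflexive (+-identityʳ _)))))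
      continue (suc N) fuel = grow N (b′ ∷ R) uR″ R′⊆L
        (≤-trans fuel (≤-reflexive (+-suc (length R) N))) shifts′
    grow N R uR R⊆L fuel shifts | no none = ⊥-elim (<-irrefl refl contra)
      where
      captured : ∀ {b e} → b ∈ a₀ ∷ R → e ∈ candidates b → e ∈ map f R
      captured {b} {e} b∈ e∈ = decidable-stable (e ∈ᴮ? map f R) λ e∉ → none (lose b∈ (lose e∈ e∉))
      counted : length (a₀ ∷ R) * d ≤ length (map f R) * d
      counted = double-count (λ e b → e ∈ᴮ? candidates b) d d (map f R) (a₀ ∷ R)
        (λ {e} _ → ≤-trans (#-⊆ (λ b → e ∈ᴮ? candidates b) uR (∷⁺ R⊆L)) (few e))
        (λ {b} b∈ → ≤-trans (proj₂ (many (∷⁺ R⊆L b∈)))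
          (unique-⊆-# (λ e → e ∈ᴮ? candidates b) (proj₁ (many (∷⁺ R⊆L b∈)))
            λ e∈ → captured b∈ e∈ , e∈))
      contra : length R * d < length R * d
      contra = ≤-trans (+-monoˡ-≤ (length R * d) 0<d)
        (≤-trans counted (≤-reflexive (cong (_* d) (length-map f R))))

    augmented : Matching (a₀ ∷ L)
    augmented = grow (length L) [] ([] ∷ []) (λ ()) ≤-refl λ { (here refl) → start }

  matching : B → ∀ L → Unique L →
    (∀ {a} → a ∈ L → Unique (candidates a) × d ≤ length (candidates a)) →
    (∀ b → # (λ a → b ∈ᴮ? candidates a) L ≤ d) → Matching L
  matching b₀ [] _ _ _ = record { rep = λ _ → b₀ ; candidate = λ () ; injective = λ () }
  matching b₀ (a ∷ L) u@(a≢ ∷ uL) many few = Augment.augmented a L u many few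
    (matching b₀ L uL (many ∘ there) λ b → ≤-trans (#-⊆ (λ x → b ∈ᴮ? candidates x) uL there) (few b))

-- Hamiltonian cycles and degree sums

record Graph (n : ℕ) : Set₁ where
  field
    Adj     : Fin n → Fin n → Set
    adj?    : ∀ u v → Dec (Adj u v)
    adj-sym : ∀ {u v} → Adj u v → Adj v u

  degree : Fin n → ℕ
  degree u = # (adj? u) (allFin n)

  Adj′ : Fin n × Fin n → Set
  Adj′ (u , v) = Adj u v

  adj′? : ∀ e → Dec (Adj′ e)
  adj′? (u , v) = adj? u v

  size : ℕ
  size = # adj′? (cartesianProduct (allFin n) (allFin n))

  -- For a loopless graph this says that non-adjacent vertices of the complement have degree sum
  -- below n: the complement equals its own Bondy-Chvátal closure.
  Stable : Set
  Stable = ∀ {u v} → Adj u v → n ≤ suc (degree u + degree v)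

steps : ∀ {A : Set} → List A → List (A × A)
steps (x ∷ y ∷ l) = (x , y) ∷ steps (y ∷ l)
steps _ = []

steps-++ : ∀ {A : Set} (xs : List A) x y ys →
  steps ((xs ∷ʳ x) ++ y ∷ ys) ≡ steps (xs ∷ʳ x) ++ (x , y) ∷ steps (y ∷ ys)
steps-++ [] x y ys = refl
steps-++ (z ∷ []) x y ys = refl
steps-++ (z ∷ w ∷ xs) x y ys = cong ((z , w) ∷_) (steps-++ (w ∷ xs) x y ys)

steps-reverse : ∀ {A : Set} (xs : List A) → steps (reverse xs) ↭ map ×-swap (steps xs)
steps-reverse [] = ↭-refl
steps-reverse (x ∷ []) = ↭-refl
steps-reverse (x ∷ y ∷ l) = begin
  steps (reverse (x ∷ y ∷ l))
    ≡⟨ cong steps (trans (unfold-reverse x (y ∷ l)) (cong (_∷ʳ x) (unfold-reverse y l))) ⟩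
  steps ((reverse l ∷ʳ y) ++ x ∷ []) ≡⟨ steps-++ (reverse l) y x [] ⟩
  steps (reverse l ∷ʳ y) ++ (y , x) ∷ [] ↭⟨ shift (y , x) (steps (reverse l ∷ʳ y)) [] ⟩
  (y , x) ∷ steps (reverse l ∷ʳ y) ++ []
    ≡⟨ cong ((y , x) ∷_) (trans (++-identityʳ _) (cong steps (sym (unfold-reverse y l)))) ⟩
  (y , x) ∷ steps (reverse (y ∷ l)) ↭⟨ prep (y , x) (steps-reverse (y ∷ l)) ⟩
  (y , x) ∷ map ×-swap (steps (y ∷ l)) ∎
  where open PermutationReasoning

∈-steps-split : ∀ {A : Set} {u v : A} l → (u , v) ∈ steps l → ∃[ us ] ∃[ vs ] l ≡ (us ∷ʳ u) ++ v ∷ vs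
∈-steps-split (x ∷ y ∷ l) (here refl) = [] , l , refl
∈-steps-split (x ∷ y ∷ l) (there p) with us , vs , eq ← ∈-steps-split (y ∷ l) p =
  x ∷ us , vs , cong (x ∷_) eq

steps-proj₂ : ∀ {A : Set} (x : A) l → map proj₂ (steps (x ∷ l)) ≡ l
steps-proj₂ x [] = refl
steps-proj₂ x (y ∷ l) = cong (y ∷_) (steps-proj₂ y l)

steps-proj₁ : ∀ {A : Set} l (x : A) → map proj₁ (steps (l ∷ʳ x)) ≡ l
steps-proj₁ [] x = refl
steps-proj₁ (y ∷ []) x = refl
steps-proj₁ (y ∷ z ∷ l) x = cong (y ∷_) (steps-proj₁ (z ∷ l) x)

unsnoc : ∀ {A : Set} (x : A) xs → ∃[ ys ] ∃[ y ] x ∷ xs ≡ ys ∷ʳ y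
unsnoc x [] = [] , x , refl
unsnoc x (x′ ∷ xs) with ys , y , e ← unsnoc x′ xs = x ∷ ys , y , cong (x ∷_) e

++-head : ∀ {A : Set} {x a : A} {xs bs} us → x ∷ xs ≡ (us ∷ʳ a) ++ bs → ∃[ ts ] us ∷ʳ a ≡ x ∷ ts
++-head [] refl = [] , refl
++-head (_ ∷ us) refl = us ∷ʳ _ , refl

closed : ∀ {A : Set} → A → List A → List (A × A)
closed x xs = steps (x ∷ xs ∷ʳ x)

module _ {n : ℕ} where

  -- The edges of `G` are the forbidden pairs, so this is a Hamiltonian cycle of the complement,
  -- given as a cyclic order.
  Avoids : Graph n → Set
  Avoids G = ∃[ x ] ∃[ xs ] x ∷ xs ↭ allFin n × All (λ e → ¬ Graph.Adj′ G e) (closed x xs)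

  module Improve (G : Graph n) where
    open Graph G

    Low : Fin n × Fin n → Set
    Low (u , v) = suc (degree u + degree v) < n

    -- The invariant of the exchange: forbidden steps may remain, but only where the degree sum is
    -- small enough for the exchange to remove them.
    Fine : Fin n × Fin n → Set
    Fine e = Adj′ e → Low e

    fine-swap : ∀ {e} → Fine e → Fine (×-swap e)
    fine-swap {u , v} f a = subst (λ d → suc d < n) (+-comm (degree u) (degree v)) (f (adj-sym a))

    bad : List (Fin n × Fin n) → ℕ
    bad = # adj′?

    bad-swap : ∀ es → bad (map ×-swap es) ≡ bad es
    bad-swap es = trans (#-map ×-swap adj′? es)
      (≤-antisym (#-mono _ _ es (λ _ → adj-sym)) (#-mono _ _ es (λ _ → adj-sym)))

    -- Reopens the cyclic order at the step `(a , b)`, leaving the path from `b` round to `a`. If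
    -- the step is not the closing one, the two pieces of the list are swapped and joined at `x`.
    cut : ∀ {a b : Fin n} x xs → (a , b) ∈ closed x xs →
      ∃[ ys ] ∃[ zs ] b ∷ ys ≡ zs ∷ʳ a × b ∷ ys ↭ x ∷ xs × (a , b) ∷ steps (b ∷ ys) ↭ closed x xs
    cut {a} {b} x xs ab∈ with us , vs , eq ← ∈-steps-split _ ab∈ with initLast vs
    ... | [] with p , refl ← ∷ʳ-injective (x ∷ xs) (us ∷ʳ a) eq =
      xs , us , p , ↭-refl , ↭-sym (begin
        steps (x ∷ xs ∷ʳ x)         ≡⟨ cong steps eq ⟩
        steps ((us ∷ʳ a) ++ x ∷ []) ≡⟨ steps-++ us a x [] ⟩
        steps (us ∷ʳ a) ++ (a , x) ∷ [] ↭⟨ shift _ _ [] ⟩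
        (a , x) ∷ steps (us ∷ʳ a) ++ [] ≡⟨ cong ((a , x) ∷_) (trans (++-identityʳ _) (cong steps (sym p))) ⟩
        (a , x) ∷ steps (x ∷ xs) ∎)
      where open PermutationReasoning
    ... | ws ∷ʳ′ w with p , refl ← ∷ʳ-injective (x ∷ xs) ((us ∷ʳ a) ++ b ∷ ws)
                        (trans eq (sym (++-assoc (us ∷ʳ a) (b ∷ ws) (w ∷ [])))) =
      ws ++ us ∷ʳ a , b ∷ ws ++ us , cong (b ∷_) (sym (++-assoc ws us (a ∷ []))) ,
      ↭-trans (++-comm (b ∷ ws) (us ∷ʳ a)) (↭-reflexive (sym p)) , rotated us p eq
      where
      open PermutationReasoning
      rotated : ∀ us → x ∷ xs ≡ (us ∷ʳ a) ++ b ∷ ws → x ∷ xs ∷ʳ x ≡ (us ∷ʳ a) ++ b ∷ ws ∷ʳ x →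
        (a , b) ∷ steps (b ∷ ws ++ us ∷ʳ a) ↭ closed x xs
      rotated us p eq = ↭-sym (begin
        steps (x ∷ xs ∷ʳ x) ≡⟨ cong steps eq ⟩
        steps ((us ∷ʳ a) ++ b ∷ ws ∷ʳ x) ≡⟨ steps-++ us a b (ws ∷ʳ x) ⟩
        steps (us ∷ʳ a) ++ (a , b) ∷ steps (b ∷ ws ∷ʳ x) ↭⟨ shift (a , b) (steps (us ∷ʳ a)) _ ⟩
        (a , b) ∷ steps (us ∷ʳ a) ++ steps (b ∷ ws ∷ʳ x) ↭⟨ prep (a , b) (++-comm (steps (us ∷ʳ a)) _) ⟩
        (a , b) ∷ steps (b ∷ ws ∷ʳ x) ++ steps (us ∷ʳ a)
          ≡⟨ cong ((a , b) ∷_) (glue (b ∷ ws) (us ∷ʳ a) (proj₂ (++-head us p))) ⟩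
        (a , b) ∷ steps (b ∷ ws ++ us ∷ʳ a) ∎)
        where
        glue : ∀ ls rs {ts} → rs ≡ x ∷ ts → steps (ls ∷ʳ x) ++ steps rs ≡ steps (ls ++ rs)
        glue [] rs refl = refl
        glue (l ∷ []) rs refl = refl
        glue (l ∷ l′ ∷ ls) rs r = cong ((l , l′) ∷_) (glue (l′ ∷ ls) rs r)

    -- The n - 1 steps of the path have distinct first ends and distinct second ends. So at most
    -- `degree a` of them begin at a neighbour of `a` and at most `degree b` end at a neighbour of
    -- `b`; as the degree sum is below n - 1, some step does neither.
    crossing : ∀ {a b} → Low (a , b) → ∀ ys zs → b ∷ ys ≡ zs ∷ʳ a → b ∷ ys ↭ allFin n →
      ∃[ u ] ∃[ v ] (u , v) ∈ steps (b ∷ ys) × ¬ Adj a u × ¬ Adj b v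
    crossing {a} {b} low ys zs eq perm =
      let (u , v) , uv∈ , ¬uv = #-exists-¬ crossed? (steps (b ∷ ys)) few
      in u , v , uv∈ , ¬uv ∘ inj₁ , ¬uv ∘ inj₂
      where
      crossed? : ∀ e → Dec (Adj a (proj₁ e) ⊎ Adj b (proj₂ e))
      crossed? (u , v) with adj? a u | adj? b v
      ... | yes p | _ = yes (inj₁ p)
      ... | no _ | yes q = yes (inj₂ q)
      ... | no ¬p | no ¬q = no λ { (inj₁ p) → ¬p p ; (inj₂ q) → ¬q q }
      n≡ : suc (length ys) ≡ n
      n≡ = trans (↭-length perm) (length-allFin n)
      from-a : # (λ e → adj? a (proj₁ e)) (steps (b ∷ ys)) ≤ degree a
      from-a = begin
        # (λ e → adj? a (proj₁ e)) (steps (b ∷ ys)) ≡⟨ sym (#-map proj₁ (adj? a) (steps (b ∷ ys))) ⟩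
        # (adj? a) (map proj₁ (steps (b ∷ ys)))
          ≡⟨ cong (# (adj? a)) (trans (cong (map proj₁ ∘ steps) eq) (steps-proj₁ zs a)) ⟩
        # (adj? a) zs                  ≤⟨ m≤m+n _ _ ⟩
        # (adj? a) zs + # (adj? a) (a ∷ []) ≡⟨ sym (#-++ (adj? a) zs (a ∷ [])) ⟩
        # (adj? a) (zs ∷ʳ a) ≡⟨ #-↭ (adj? a) (↭-trans (↭-reflexive (sym eq)) perm) ⟩
        degree a ∎
        where open ≤-Reasoning
      from-b : # (λ e → adj? b (proj₂ e)) (steps (b ∷ ys)) ≤ degree b
      from-b = begin
        # (λ e → adj? b (proj₂ e)) (steps (b ∷ ys)) ≡⟨ sym (#-map proj₂ (adj? b) (steps (b ∷ ys))) ⟩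
        # (adj? b) (map proj₂ (steps (b ∷ ys))) ≡⟨ cong (# (adj? b)) (steps-proj₂ b ys) ⟩
        # (adj? b) ys ≤⟨ m≤n+m _ _ ⟩
        # (adj? b) (b ∷ []) + # (adj? b) ys ≡⟨ sym (#-++ (adj? b) (b ∷ []) ys) ⟩
        # (adj? b) (b ∷ ys) ≡⟨ #-↭ (adj? b) perm ⟩
        degree b ∎
        where open ≤-Reasoning
      few : # crossed? (steps (b ∷ ys)) < length (steps (b ∷ ys))
      few = begin-strict
        # crossed? (steps (b ∷ ys)) ≤⟨ #-∪ crossed? (λ e → adj? a (proj₁ e)) (λ e → adj? b (proj₂ e)) _ (λ _ → id) ⟩
        _ ≤⟨ +-mono-≤ from-a from-b ⟩
        degree a + degree b <⟨ s≤s⁻¹ (≤-trans low (≤-reflexive (sym n≡))) ⟩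
        length ys ≡⟨ cong length (sym (steps-proj₂ b ys)) ⟩
        length (map proj₂ (steps (b ∷ ys))) ≡⟨ length-map proj₂ (steps (b ∷ ys)) ⟩
        length (steps (b ∷ ys)) ∎
        where open ≤-Reasoning

    -- Ore's exchange: b … u v … a becomes b … u a … v, closed up by (v , b).
    exchange : ∀ {a b} → Low (a , b) → ∀ ys zs → b ∷ ys ≡ zs ∷ʳ a → b ∷ ys ↭ allFin n →
      All Fine (steps (b ∷ ys)) →
      ∃[ ws ] b ∷ ws ↭ allFin n × All Fine (closed b ws) × bad (closed b ws) ≤ bad (steps (b ∷ ys))
    exchange {a} {b} low ys zs eq perm fine
      with u , v , uv∈ , ¬au , ¬bv ← crossing low ys zs eq perm
      with us , vs , split ← ∈-steps-split _ uv∈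
      with ts , hd ← ++-head us split
      = ts ++ reverse (v ∷ vs) , perm′ , All-resp-↭ (↭-sym new) fine′ , bad≤
      where
      last : ∃[ ws ] v ∷ vs ≡ ws ∷ʳ a
      last with ws , w , e ← unsnoc v vs = ws , trans e (cong (ws ∷ʳ_) (∷ʳ-injectiveʳ ((us ∷ʳ u) ++ ws) zs
        (trans (++-assoc (us ∷ʳ u) ws (w ∷ []))
          (trans (cong ((us ∷ʳ u) ++_) (sym e)) (trans (sym split) eq)))))
      perm′ : b ∷ ts ++ reverse (v ∷ vs) ↭ allFin n
      perm′ = ↭-trans (++⁺ˡ (b ∷ ts) (↭-reverse (v ∷ vs)))
        (↭-trans (↭-reflexive (trans (cong (_++ v ∷ vs) (sym hd)) (sym split))) perm)
      new : closed b (ts ++ reverse (v ∷ vs)) ↭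
        (u , a) ∷ (v , b) ∷ steps (us ∷ʳ u) ++ map ×-swap (steps (v ∷ vs))
      new with ws , lst ← last = begin
        steps (b ∷ (ts ++ reverse (v ∷ vs)) ∷ʳ b)
          ≡⟨ cong (steps ∘ (b ∷_)) (++-assoc ts (reverse (v ∷ vs)) (b ∷ [])) ⟩
        steps ((b ∷ ts) ++ reverse (v ∷ vs) ∷ʳ b)
          ≡⟨ cong₂ (λ l r → steps (l ++ r ∷ʳ b)) (sym hd) (rev lst) ⟩
        steps ((us ∷ʳ u) ++ a ∷ reverse ws ∷ʳ b) ≡⟨ steps-++ us u a (reverse ws ∷ʳ b) ⟩
        steps (us ∷ʳ u) ++ (u , a) ∷ steps (a ∷ reverse ws ∷ʳ b)
          ↭⟨ shift (u , a) (steps (us ∷ʳ u)) _ ⟩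
        (u , a) ∷ steps (us ∷ʳ u) ++ steps ((a ∷ reverse ws) ∷ʳ b)
          ≡⟨ cong (λ l → (u , a) ∷ steps (us ∷ʳ u) ++ steps (l ∷ʳ b)) (trans (sym (rev lst)) (unfold-reverse v vs)) ⟩
        (u , a) ∷ steps (us ∷ʳ u) ++ steps ((reverse vs ∷ʳ v) ++ b ∷ [])
          ≡⟨ cong (λ l → (u , a) ∷ steps (us ∷ʳ u) ++ l) (trans (steps-++ (reverse vs) v b [])
               (cong (λ l → steps l ++ (v , b) ∷ []) (sym (unfold-reverse v vs)))) ⟩
        (u , a) ∷ steps (us ∷ʳ u) ++ steps (reverse (v ∷ vs)) ++ (v , b) ∷ []
          ↭⟨ prep (u , a) (++⁺ˡ (steps (us ∷ʳ u)) (++-comm (steps (reverse (v ∷ vs))) ((v , b) ∷ []))) ⟩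
        (u , a) ∷ steps (us ∷ʳ u) ++ (v , b) ∷ steps (reverse (v ∷ vs))
          ↭⟨ prep (u , a) (shift (v , b) (steps (us ∷ʳ u)) _) ⟩
        (u , a) ∷ (v , b) ∷ steps (us ∷ʳ u) ++ steps (reverse (v ∷ vs))
          ↭⟨ prep (u , a) (prep (v , b) (++⁺ˡ (steps (us ∷ʳ u)) (steps-reverse (v ∷ vs)))) ⟩
        (u , a) ∷ (v , b) ∷ steps (us ∷ʳ u) ++ map ×-swap (steps (v ∷ vs)) ∎
        where
        open PermutationReasoning
        rev : ∀ {ws} → v ∷ vs ≡ ws ∷ʳ a → reverse (v ∷ vs) ≡ a ∷ reverse ws
        rev {ws} lst = trans (cong reverse lst) (reverse-++ ws (a ∷ []))
      old : steps (b ∷ ys) ≡ steps (us ∷ʳ u) ++ (u , v) ∷ steps (v ∷ vs)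
      old = trans (cong steps split) (steps-++ us u v vs)
      fine-old : All Fine (steps (us ∷ʳ u) ++ (u , v) ∷ steps (v ∷ vs))
      fine-old = subst (All Fine) old fine
      fine′ : All Fine ((u , a) ∷ (v , b) ∷ steps (us ∷ʳ u) ++ map ×-swap (steps (v ∷ vs)))
      fine′ = (⊥-elim ∘ ¬au ∘ adj-sym) ∷ (⊥-elim ∘ ¬bv ∘ adj-sym) ∷
        All.++⁺ (All.++⁻ˡ (steps (us ∷ʳ u)) fine-old)
          (All.map⁺ (All.map (λ {e} → fine-swap {e}) (All.tail (All.++⁻ʳ (steps (us ∷ʳ u)) fine-old))))
      bad≤ : bad (closed b (ts ++ reverse (v ∷ vs))) ≤ bad (steps (b ∷ ys))
      bad≤ = begin
        bad (closed b (ts ++ reverse (v ∷ vs))) ≡⟨ #-↭ adj′? new ⟩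
        bad ((u , a) ∷ (v , b) ∷ rest) ≡⟨ #-++ adj′? ((u , a) ∷ (v , b) ∷ []) rest ⟩
        bad ((u , a) ∷ (v , b) ∷ []) + bad rest ≡⟨ cong (_+ bad rest) (#-none adj′? _ λ
            { (here refl) → ¬au ∘ adj-sym ; (there (here refl)) → ¬bv ∘ adj-sym }) ⟩
        bad rest ≡⟨ #-++ adj′? (steps (us ∷ʳ u)) _ ⟩
        bad (steps (us ∷ʳ u)) + bad (map ×-swap (steps (v ∷ vs)))
          ≡⟨ cong (bad (steps (us ∷ʳ u)) +_) (bad-swap (steps (v ∷ vs))) ⟩
        bad (steps (us ∷ʳ u)) + bad (steps (v ∷ vs))
          ≤⟨ +-monoʳ-≤ (bad (steps (us ∷ʳ u))) (m≤n+m _ (bad ((u , v) ∷ []))) ⟩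
        bad (steps (us ∷ʳ u)) + (bad ((u , v) ∷ []) + bad (steps (v ∷ vs)))
          ≡⟨ cong (bad (steps (us ∷ʳ u)) +_) (sym (#-++ adj′? ((u , v) ∷ []) _)) ⟩
        bad (steps (us ∷ʳ u)) + bad ((u , v) ∷ steps (v ∷ vs))
          ≡⟨ sym (#-++ adj′? (steps (us ∷ʳ u)) _) ⟩
        bad (steps (us ∷ʳ u) ++ (u , v) ∷ steps (v ∷ vs)) ≡⟨ cong bad (sym old) ⟩
        bad (steps (b ∷ ys)) ∎
        where
        open ≤-Reasoning
        rest = steps (us ∷ʳ u) ++ map ×-swap (steps (v ∷ vs))

    -- The forbidden step `(a , b)` disappears when the cycle is cut there, and the exchange adds
    -- none; hence the strict decrease.
    improve-once : ∀ x xs → x ∷ xs ↭ allFin n → All Fine (closed x xs) → 0 < bad (closed x xs) →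
      ∃[ y ] ∃[ ys ] y ∷ ys ↭ allFin n × All Fine (closed y ys) ×
        bad (closed y ys) < bad (closed x xs)
    improve-once x xs perm fine pos =
      let (a , b) , ab∈ , adj = #-exists adj′? (closed x xs) pos
          ys , zs , last , perm₁ , steps↭ = cut x xs ab∈
          ws , perm₂ , fine₂ , bad₂ = exchange (All.lookup fine ab∈ adj) ys zs last
            (↭-trans perm₁ perm) (All.tail (All-resp-↭ (↭-sym steps↭) fine))
      in b , ws , perm₂ , fine₂ , ≤-trans (s≤s bad₂) (fewer adj steps↭)
      where
      fewer : ∀ {e es} → Adj′ e → e ∷ es ↭ closed x xs → bad es < bad (closed x xs)
      fewer {e} {es} adj es↭ = ≤-reflexive (begin
        1 + bad es            ≡⟨ cong (_+ bad es) (sym (#-all adj′? (e ∷ []) λ { (here refl) → adj })) ⟩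
        bad (e ∷ []) + bad es ≡⟨ sym (#-++ adj′? (e ∷ []) es) ⟩
        bad (e ∷ es)          ≡⟨ #-↭ adj′? es↭ ⟩
        bad (closed x xs)     ∎)
        where open ≡-Reasoning

    improve : ∀ N x xs → bad (closed x xs) ≤ N → x ∷ xs ↭ allFin n → All Fine (closed x xs) → Avoids G
    improve N x xs le perm fine with 0 <? bad (closed x xs)
    ... | no none = x , xs , perm , All.tabulate λ e∈ a → none
      (unique-⊆-# adj′? ([] ∷ []) λ { (here refl) → e∈ , a })
    improve zero x xs le perm fine | yes pos = ⊥-elim (n≮0 (≤-trans pos le))
    improve (suc N) x xs le perm fine | yes pos =
      let y , ys , perm′ , fine′ , lt = improve-once x xs perm fine pos
      in improve N y ys (s≤s⁻¹ (≤-trans lt le)) perm′ fine′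

edgeless : ∀ {n} → 0 < n → (H : Graph n) → ¬ (∃[ u ] ∃[ v ] Graph.Adj H u v) → Avoids H
edgeless z<s H empty = zero , _ , ↭-refl , All.tabulate λ _ a → empty (_ , _ , a)

-- Repeatedly discarding the edges of small degree sum ends in a stable graph; if nothing is
-- left, Ore's exchange turns any cyclic order into one avoiding the original graph.
ore : ∀ {n} N (G : Graph n) → Graph.size G ≤ N → 0 < n →
  Avoids G ⊎ ∃[ H ] (∀ {u v} → Graph.Adj H u v → Graph.Adj G u v) × Graph.Stable H ×
    ∃[ u ] ∃[ v ] Graph.Adj H u v
ore {n} N G le 0<n with Fin.any? (λ u → Fin.any? λ v → Graph.adj? G u v)
... | no empty = inj₁ (edgeless 0<n G empty)
... | yes (u₀ , v₀ , edge)
  with Fin.any? (λ u → Fin.any? λ v →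
         Graph.adj? G u v ×-dec suc (Graph.degree G u + Graph.degree G v) <? n)
...   | no stable =
  inj₂ (G , id , (λ {u} {v} a → ≮⇒≥ λ lt → stable (u , v , a , lt)) , u₀ , v₀ , edge)
...   | yes (u , v , a , lt) = descend N le
  where
  open Graph G
  G⁻ : Graph n
  G⁻ = record
    { Adj = λ u v → Adj u v × ¬ suc (degree u + degree v) < n
    ; adj? = λ u v → adj? u v ×-dec ¬? (suc (degree u + degree v) <? n)
    ; adj-sym = λ {u} {v} (a , h) → adj-sym a , λ lt →
        h (subst (λ d → suc d < n) (+-comm (degree v) (degree u)) lt) }
  smaller : Graph.size G⁻ < size
  smaller = #-strict (Graph.adj′? G⁻) adj′? proj₁ (∈-cartesianProduct⁺ (∈-allFin u) (∈-allFin v)) a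
    λ (_ , h) → h lt
  descend : ∀ N → size ≤ N →
    Avoids G ⊎ ∃[ H ] (∀ {u v} → Graph.Adj H u v → Adj u v) × Graph.Stable H ×
      ∃[ u ] ∃[ v ] Graph.Adj H u v
  descend zero le = ⊥-elim (n≮0 (≤-trans smaller le))
  descend (suc N) le with ore N G⁻ (s≤s⁻¹ (≤-trans smaller le)) 0<n
  -- A step that avoids `G⁻` is forbidden in `G` only if its degree sum is small, which is the
  -- invariant `Fine`.
  ... | inj₁ (x , xs , perm , avoids) = inj₁ (improve _ x xs ≤-refl perm
          (All.map (λ ¬a a′ → decidable-stable (_ <? n) λ h → ¬a (a′ , h)) avoids))
    where open Improve G
  ... | inj₂ (H , H⊆ , rest) = inj₂ (H , proj₁ ∘ H⊆ , rest)

-- The cyclic successor, and cyclic orders as functions on positions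

next-inject₁ : ∀ {m} (i : Fin m) → next (inject₁ i) ≡ suc i
next-inject₁ zero = refl
next-inject₁ (suc i) rewrite next-inject₁ i = refl

next-fromℕ : ∀ m → next (fromℕ m) ≡ zero
next-fromℕ zero = refl
next-fromℕ (suc m) rewrite next-fromℕ m = refl

prev : ∀ {m} → Fin (suc m) → Fin (suc m)
prev {m} zero = fromℕ m
prev (suc i) = inject₁ i

prev-next : ∀ {m} (i : Fin (suc m)) → prev (next i) ≡ i
prev-next i with view i
... | ‵fromℕ {m} rewrite next-fromℕ m = refl
... | ‵inject₁ j rewrite next-inject₁ j = refl

toℕ-next : ∀ {m} (i : Fin (suc m)) →
  toℕ (next i) ≡ suc (toℕ i) ⊎ toℕ i ≡ m × toℕ (next i) ≡ 0
toℕ-next i with view i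
... | ‵fromℕ {m} rewrite next-fromℕ m = inj₂ (Fin.toℕ-fromℕ m , refl)
... | ‵inject₁ j rewrite next-inject₁ j = inj₁ (cong suc (sym (Fin.toℕ-inject₁ j)))

-- False for one or two positions. It keeps a pair of vertices from being traversed at two positions
-- in opposite directions.
next-next≢ : ∀ {m} → 2 ≤ m → (i : Fin (suc m)) → next (next i) ≢ i
next-next≢ {m} 2≤m i eq with toℕ-next i | toℕ-next (next i)
... | inj₁ p | inj₁ q = m≢1+m+n (toℕ i) {1} (trans (sym (cong toℕ eq))
        (trans q (trans (cong suc p) (cong suc (sym (+-comm (toℕ i) 1))))))
... | inj₁ p | inj₂ (q , s) = <-irrefl (trans (cong suc (trans (sym s) (cong toℕ eq))) (trans (sym p) q)) 2≤m
... | inj₂ (p , s) | inj₁ q = <-irrefl (trans (cong suc (sym s)) (trans (sym q) (trans (cong toℕ eq) p))) 2≤m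
... | inj₂ (p , s) | inj₂ (q , _) = <-irrefl (trans (sym s) q) (≤-trans (s≤s z≤n) 2≤m)

module _ {A : Set} where

  private
    -- The entry behind position `i` in `x ∷ xs ∷ʳ z`, whatever the head `x`. For z = x it
    -- translates `steps` into `next`.
    after : (xs : List A) → A → Fin (suc (length xs)) → A
    after [] z zero = z
    after (y ∷ ys) z zero = y
    after (y ∷ ys) z (suc i) = after ys z i

    after-next : ∀ (xs : List A) z i → after xs z i ≡ lookup (z ∷ xs) (next i)
    after-next [] z zero = refl
    after-next (y ∷ ys) z zero = refl
    after-next (y ∷ ys) z (suc i) with next i | after-next ys z i
    ... | zero | eq = eq
    ... | suc j | eq = eq

    All-after : ∀ {P : A × A → Set} x (xs : List A) z → All P (steps (x ∷ xs ∷ʳ z)) →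
      ∀ i → P (lookup (x ∷ xs) i , after xs z i)
    All-after x [] z (p ∷ []) zero = p
    All-after x (y ∷ ys) z (p ∷ ps) zero = p
    All-after x (y ∷ ys) z (p ∷ ps) (suc i) = All-after y ys z ps i

    lookup-injective : ∀ {xs : List A} → Unique xs → ∀ i j → lookup xs i ≡ lookup xs j → i ≡ j
    lookup-injective (x≢ ∷ u) zero zero eq = refl
    lookup-injective (x≢ ∷ u) zero (suc j) eq = ⊥-elim (All.lookup x≢ (∈-lookup j) eq)
    lookup-injective (x≢ ∷ u) (suc i) zero eq = ⊥-elim (All.lookup x≢ (∈-lookup i) (sym eq))
    lookup-injective (x≢ ∷ u) (suc i) (suc j) eq = cong suc (lookup-injective u i j eq)

  cyclic : ∀ {m} {P : A × A → Set} x (xs : List A) → length xs ≡ m → Unique (x ∷ xs) → All P (closed x xs) →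
    Σ[ v ∈ (Fin (suc m) → A) ] (∀ {i j} → v i ≡ v j → i ≡ j) × (∀ i → P (v i , v (next i)))
  cyclic {P = P} x xs refl u ps = lookup (x ∷ xs) , lookup-injective u _ _ ,
    λ i → subst (λ y → P (lookup (x ∷ xs) i , y)) (after-next xs x i) (All-after x xs x ps i)

avoiding-cycle : ∀ {m} (G : Graph (suc m)) → Avoids G →
  Σ[ v ∈ (Fin (suc m) → Fin (suc m)) ] (∀ {i j} → v i ≡ v j → i ≡ j) × (∀ i → ¬ Graph.Adj G (v i) (v (next i)))
avoiding-cycle {m} G (x , xs , perm , avoids) =
  cyclic x xs (suc-injective (trans (↭-length perm) (length-allFin (suc m))))
    (↭ₛ.Unique-resp-↭ (setoid _) (↭⇒↭ₛ (↭-sym perm)) (Unique.allFin⁺ (suc m))) avoids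

-- Finite sets of vertices

module Subsets where

  private
    variable
      n : ℕ

  subsets : ∀ n → List (Subset n)
  subsets zero = [] ∷ []
  subsets (suc n) = map (inside ∷_) (subsets n) ++ map (outside ∷_) (subsets n)

  ∈-subsets : (p : Subset n) → p ∈ subsets n
  ∈-subsets [] = here refl
  ∈-subsets (true ∷ p) = ∈-++⁺ˡ (∈-map⁺ (inside ∷_) (∈-subsets p))
  ∈-subsets {suc n} (false ∷ p) = ∈-++⁺ʳ (map (inside ∷_) (subsets n)) (∈-map⁺ (outside ∷_) (∈-subsets p))

  subsets-unique : ∀ n → Unique (subsets n)
  subsets-unique zero = [] ∷ []
  subsets-unique (suc n) = Unique.++⁺ (Unique.map⁺ ∷-injectiveʳ (subsets-unique n))
    (Unique.map⁺ ∷-injectiveʳ (subsets-unique n)) disjoint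
    where
    disjoint : ∀ {p} → p ∈ map (inside ∷_) (subsets n) × p ∈ map (outside ∷_) (subsets n) → ⊥
    disjoint (a , b) with ∈-map⁻ (inside ∷_) a | ∈-map⁻ (outside ∷_) b
    ... | _ , _ , refl | _ , _ , ()

  count : {P : Fin n → Set} → (∀ x → Dec (P x)) → ℕ
  count {n} P? = # P? (allFin n)

  ∣p∣≡count : (p : Subset n) → ∣ p ∣ ≡ count (_∈? p)
  ∣p∣≡count [] = sym (#-none (_∈? []) [] λ ())
  ∣p∣≡count {suc n} (s ∷ p) = sym (begin
    # (_∈? (s ∷ p)) (zero ∷ List.tabulate suc)
      ≡⟨ #-++ (_∈? (s ∷ p)) (zero ∷ []) (List.tabulate suc) ⟩
    # (_∈? (s ∷ p)) (zero ∷ []) + # (_∈? (s ∷ p)) (List.tabulate suc)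
      ≡⟨ cong (# (_∈? (s ∷ p)) (zero ∷ []) +_) rest ⟩
    # (_∈? (s ∷ p)) (zero ∷ []) + ∣ p ∣ ≡⟨ first s ⟩
    ∣ s ∷ p ∣ ∎)
    where
    open ≡-Reasoning
    rest : # (_∈? (s ∷ p)) (List.tabulate suc) ≡ ∣ p ∣
    rest = begin
      # (_∈? (s ∷ p)) (List.tabulate suc) ≡⟨ cong (# (_∈? (s ∷ p))) (sym (map-tabulate id suc)) ⟩
      # (_∈? (s ∷ p)) (map suc (allFin n)) ≡⟨ #-map suc (_∈? (s ∷ p)) (allFin n) ⟩
      # (λ x → suc x ∈? (s ∷ p)) (allFin n)
        ≡⟨ ≤-antisym (#-mono _ _ (allFin n) λ _ → drop-there) (#-mono _ _ (allFin n) λ _ → there) ⟩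
      # (_∈? p) (allFin n) ≡⟨ sym (∣p∣≡count p) ⟩
      ∣ p ∣ ∎
    first : ∀ s → # (_∈? (s ∷ p)) (zero ∷ []) + ∣ p ∣ ≡ ∣ s ∷ p ∣
    first true = cong (_+ ∣ p ∣) (#-all (_∈? (true ∷ p)) (zero ∷ []) λ { (here refl) → here })
    first false = cong (_+ ∣ p ∣) (#-none (_∈? (false ∷ p)) (zero ∷ []) λ { (here refl) () })

  count-≡ : (x : Fin n) → count (Fin._≟ x) ≤ 1
  count-≡ {n} x = ≤-trans (≤-reflexive (#-filter (Fin._≟ x) (allFin n)))
    (unique-⊆-length {ys = x ∷ []} (Unique.filter⁺ (Fin._≟ x) (Unique.allFin⁺ n))
      λ y∈ → here (proj₂ (∈-filter⁻ (Fin._≟ x) {xs = allFin n} y∈)))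

  count-total : {P : Fin n → Set} (P? : ∀ x → Dec (P x)) → count P? + count (¬? ∘ P?) ≡ n
  count-total {n} P? = trans (#-complement P? (allFin n)) (length-allFin n)

  count-mono : {P Q : Fin n → Set} (P? : ∀ x → Dec (P x)) (Q? : ∀ x → Dec (Q x)) →
    (∀ {x} → P x → Q x) → count P? ≤ count Q?
  count-mono {n} P? Q? f = #-mono P? Q? (allFin n) λ _ → f

  count-∪ : {P Q R : Fin n → Set} (P? : ∀ x → Dec (P x)) (Q? : ∀ x → Dec (Q x)) (R? : ∀ x → Dec (R x)) →
    (∀ {x} → P x → Q x ⊎ R x) → count P? ≤ count Q? + count R?
  count-∪ {n} P? Q? R? f = #-∪ P? Q? R? (allFin n) λ _ → f

  count-⋃ : ∀ {I : Set} {P : Fin n → Set} (P? : ∀ x → Dec (P x))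
    {Q : I → Fin n → Set} (Q? : ∀ i x → Dec (Q i x)) (is : List I) (N : ℕ) →
    (∀ {i} → i ∈ is → count (Q? i) ≤ N) → (∀ {x} → P x → ∃[ i ] i ∈ is × Q i x) →
    count P? ≤ length is * N
  count-⋃ {n} P? Q? is N b f = #-⋃ P? Q? is N (allFin n) b λ _ → f

  #-excluding : ∀ {k} {A : Set} (i : Fin k) {Q : Fin k → A → Set} (Q? : ∀ j x → Dec (Q j x)) xs {N} →
    (∀ j → j ≢ i → # (Q? j) xs ≤ N) → ∀ j → # (λ x → ¬? (j Fin.≟ i) ×-dec Q? j x) xs ≤ N
  #-excluding i Q? xs bound j with j Fin.≟ i
  ... | yes j≡i = ≤-trans (≤-reflexive (#-none _ xs λ _ (j≢i , _) → j≢i j≡i)) z≤n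
  ... | no j≢i = ≤-trans (#-mono _ (Q? j) xs λ _ → proj₂) (bound j j≢i)

  count-exists : {P : Fin n → Set} (P? : ∀ x → Dec (P x)) → count P? < n → ∃[ x ] ¬ P x
  count-exists {n} P? lt = let x , _ , ¬p = #-exists-¬ P? (allFin n) (subst (count P? <_) (sym (length-allFin n)) lt)
    in x , ¬p

  infixl 6 _⊕_

  opaque
    _⊕_ : Subset n → Fin n → Subset n
    p ⊕ x = p ∪ ⁅ x ⁆

    x∈p⊕x : (p : Subset n) (x : Fin n) → x ∈ˢ p ⊕ x
    x∈p⊕x p x = q⊆p∪q p ⁅ x ⁆ (x∈⁅x⁆ x)

    p⊆p⊕x : (p : Subset n) (x : Fin n) → p ⊆ˢ p ⊕ x
    p⊆p⊕x p x = p⊆p∪q ⁅ x ⁆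

    ∈-⊕⁻ : (p : Subset n) (x : Fin n) → ∀ {y} → y ∈ˢ p ⊕ x → y ∈ˢ p ⊎ y ≡ x
    ∈-⊕⁻ p x y∈ with x∈p∪q⁻ p ⁅ x ⁆ y∈
    ... | inj₁ a = inj₁ a
    ... | inj₂ b = inj₂ (x∈⁅y⁆⇒x≡y x b)

    ⊕-comm : (p : Subset n) (x y : Fin n) → p ⊕ x ⊕ y ≡ p ⊕ y ⊕ x
    ⊕-comm p x y = begin
      (p ∪ ⁅ x ⁆) ∪ ⁅ y ⁆ ≡⟨ ∪-assoc p ⁅ x ⁆ ⁅ y ⁆ ⟩
      p ∪ (⁅ x ⁆ ∪ ⁅ y ⁆) ≡⟨ cong (p ∪_) (∪-comm ⁅ x ⁆ ⁅ y ⁆) ⟩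
      p ∪ (⁅ y ⁆ ∪ ⁅ x ⁆) ≡⟨ sym (∪-assoc p ⁅ y ⁆ ⁅ x ⁆) ⟩
      (p ∪ ⁅ y ⁆) ∪ ⁅ x ⁆ ∎
      where open ≡-Reasoning

  ∣p⊕x∣≤ : (p : Subset n) (x : Fin n) → ∣ p ⊕ x ∣ ≤ suc ∣ p ∣
  ∣p⊕x∣≤ p x = begin
    ∣ p ⊕ x ∣ ≡⟨ ∣p∣≡count (p ⊕ x) ⟩
    count (_∈? (p ⊕ x)) ≤⟨ count-∪ _ (_∈? p) (Fin._≟ x) (∈-⊕⁻ p x) ⟩
    count (_∈? p) + count (Fin._≟ x) ≤⟨ +-mono-≤ (≤-reflexive (sym (∣p∣≡count p))) (count-≡ x) ⟩
    ∣ p ∣ + 1 ≡⟨ +-comm ∣ p ∣ 1 ⟩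
    suc ∣ p ∣ ∎
    where open ≤-Reasoning

  ∣p⊕x∣ : (p : Subset n) (x : Fin n) → x ∉ˢ p → ∣ p ⊕ x ∣ ≡ suc ∣ p ∣
  ∣p⊕x∣ p x x∉ = ≤-antisym (∣p⊕x∣≤ p x) (p⊂q⇒∣p∣<∣q∣ (p⊆p⊕x p x , x , x∈p⊕x p x , x∉))

  ⊕-injective : (p : Subset n) {x y : Fin n} → x ∉ˢ p → p ⊕ x ≡ p ⊕ y → x ≡ y
  ⊕-injective p {x} {y} x∉ eq with ∈-⊕⁻ p y (subst (x ∈ˢ_) eq (x∈p⊕x p x))
  ... | inj₁ x∈ = ⊥-elim (x∉ x∈)
  ... | inj₂ x≡y = x≡y

  pad : ∀ N (p : Subset n) → ∣ p ∣ ≤ N → N ≤ n → ∃[ q ] p ⊆ˢ q × ∣ q ∣ ≡ N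
  pad {n} N p le N≤n = go (N ∸ ∣ p ∣) p (m∸n+n≡m le)
    where
    go : ∀ d (p : Subset n) → d + ∣ p ∣ ≡ N → ∃[ q ] p ⊆ˢ q × ∣ q ∣ ≡ N
    go zero p eq = p , id , eq
    go (suc d) p eq =
      let x , x∉ = count-exists (_∈? p) (≤-trans (s≤s (≤-reflexive (sym (∣p∣≡count p))))
            (≤-trans (≤-trans (s≤s (m≤n+m _ d)) (≤-reflexive eq)) N≤n))
          q , sub , ∣q∣ = go d (p ⊕ x) (trans (trans (cong (d +_) (∣p⊕x∣ p x x∉)) (+-suc d _)) eq)
      in q , sub ∘ p⊆p⊕x p x , ∣q∣

  opaque
    fromList : List (Fin n) → Subset n
    fromList = foldr (λ x p → p ⊕ x) ∅

    ∈-fromList : ∀ {xs} {x : Fin n} → x ∈ xs → x ∈ˢ fromList xs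
    ∈-fromList {xs = y ∷ xs} (here refl) = x∈p⊕x (fromList xs) y
    ∈-fromList {xs = y ∷ xs} (there x∈) = p⊆p⊕x (fromList xs) y (∈-fromList x∈)

    ∣fromList∣≤ : (xs : List (Fin n)) → ∣ fromList xs ∣ ≤ length xs
    ∣fromList∣≤ {n} [] = ≤-reflexive (∣⊥∣≡0 n)
    ∣fromList∣≤ (x ∷ xs) = ≤-trans (∣p⊕x∣≤ (fromList xs) x) (s≤s (∣fromList∣≤ xs))

    ∈-fromList⁻ : ∀ (xs : List (Fin n)) {x} → x ∈ˢ fromList xs → x ∈ xs
    ∈-fromList⁻ [] x∈ = ⊥-elim (∉⊥ x∈)
    ∈-fromList⁻ (y ∷ xs) x∈ with ∈-⊕⁻ (fromList xs) y x∈
    ... | inj₁ a = there (∈-fromList⁻ xs a)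
    ... | inj₂ b = here b

    ∣fromList∣ : {xs : List (Fin n)} → Unique xs → ∣ fromList xs ∣ ≡ length xs
    ∣fromList∣ {n} [] = ∣⊥∣≡0 n
    ∣fromList∣ {xs = x ∷ xs} u@(_ ∷ u′) =
      trans (∣p⊕x∣ (fromList xs) x (Unique.Unique[x∷xs]⇒x∉xs u ∘ ∈-fromList⁻ xs)) (cong suc (∣fromList∣ u′))

open Subsets

-- Light pairs

module Colour (m k t : ℕ) (χ : Colouring (suc m) k) where

  n = suc m

  V = Fin n

  -- Here `k` is the number of colours r - 1, so edges have `suc k` vertices.
  EdgeOn : Fin k → V → V → Subset n → Set
  EdgeOn i u v S = ∣ S ∣ ≡ suc k × u ∈ˢ S × v ∈ˢ S × χ S ≡ i

  opaque
    edgeOn? : ∀ i u v S → Dec (EdgeOn i u v S)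
    edgeOn? i u v S = ∣ S ∣ ≟ suc k ×-dec u ∈? S ×-dec v ∈? S ×-dec χ S Fin.≟ i

  codegree : Fin k → V → V → ℕ
  codegree i u v = # (edgeOn? i u v) (subsets n)

  codegree-sym : ∀ i u v → codegree i u v ≤ codegree i v u
  codegree-sym i u v = #-mono _ _ (subsets n) λ _ (s , u∈ , v∈ , c) → s , v∈ , u∈ , c

  Light : Fin k → V → V → Set
  Light i u v = u ≢ v × codegree i u v < t

  opaque
    light? : ∀ i u v → Dec (Light i u v)
    light? i u v = ¬? (u Fin.≟ v) ×-dec codegree i u v <? t

  light-sym : ∀ {i u v} → Light i u v → Light i v u
  light-sym {i} {u} {v} (u≢v , lt) = u≢v ∘ sym , ≤-trans (s≤s (codegree-sym i v u)) lt

  Covers : Fin k → Subset n → Set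
  Covers i W = ∃[ u ] ∃[ v ] u ∈ˢ W × v ∈ˢ W × Light i u v

  covers-mono : ∀ {i W W′} → W ⊆ˢ W′ → Covers i W → Covers i W′
  covers-mono W⊆ (u , v , u∈ , v∈ , l) = u , v , W⊆ u∈ , W⊆ v∈ , l

  Extends : Subset n → Fin k → V → Set
  Extends W i z = z ∉ˢ W × χ (W ⊕ z) ≡ i

  opaque
    extends? : ∀ W i z → Dec (Extends W i z)
    extends? W i z = ¬? (z ∈? W) ×-dec χ (W ⊕ z) Fin.≟ i

  -- The map z ↦ `W ⊕ z` injects these vertices into the edges of colour `i` on the light pair
  -- inside `W`.
  few-extensions : ∀ {W i} → ∣ W ∣ ≡ k → Covers i W →
    ∀ {zs} → Unique zs → # (extends? W i) zs < t
  few-extensions {W} {i} ∣W∣ (u , v , u∈ , v∈ , _ , lt) uz = ≤-trans (s≤s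
    (#-inj (extends? W i) (edgeOn? i u v) (W ⊕_) uz (λ (z∉ , _) _ → ⊕-injective W z∉)
      λ {z} _ (z∉ , c) → ∈-subsets (W ⊕ z) ,
        trans (∣p⊕x∣ W z z∉) (cong suc ∣W∣) , p⊆p⊕x W z u∈ , p⊆p⊕x W z v∈ , c)) lt

  -- Each of the n - k vertices z outside the padded set gives an edge `W ⊕ z` of some colour, while
  -- each of the `k` colours can occur fewer than `t` times.
  not-all-covered : k + k * t < n → ∀ {W} → ∣ W ∣ ≤ k → ¬ (∀ i → Covers i W)
  not-all-covered large {W₀} ∣W₀∣ cov₀ =
    let W , W₀⊆W , ∣W∣ = pad k W₀ ∣W₀∣ (≤-trans (m≤m+n k (k * t)) (<⇒≤ large))
        outside≤ = count-⋃ (λ z → ¬? (z ∈? W)) (extends? W) (allFin k) t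
          (λ _ → <⇒≤ (few-extensions ∣W∣ (covers-mono W₀⊆W (cov₀ _)) (Unique.allFin⁺ n)))
          (λ {z} z∉ → χ (W ⊕ z) , ∈-allFin _ , z∉ , refl)
    in <-irrefl refl (begin-strict
      n ≡⟨ sym (count-total (_∈? W)) ⟩
      count (_∈? W) + count (λ z → ¬? (z ∈? W))
        ≤⟨ +-mono-≤ (≤-reflexive (trans (sym (∣p∣≡count W)) ∣W∣))
             (subst (λ l → count (λ z → ¬? (z ∈? W)) ≤ l * t) (length-allFin k) outside≤) ⟩
      k + k * t <⟨ large ⟩
      n ∎)
    where open ≤-Reasoning

  -- For fixed x only few y can give W ∪ {x , y} a colour other than b, while for fixed y only
  -- few x can give it colour b.
  two-freedoms : ∀ {W b X Y} → suc ∣ W ∣ ≡ k → Unique X → Unique Y →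
    (∀ {x} → x ∈ X → x ∉ˢ W) → (∀ {y} → y ∈ Y → y ∉ˢ W) → (∀ {x y} → x ∈ X → y ∈ Y → x ≢ y) →
    (∀ {x} → x ∈ X → ∀ j → j ≢ b → Covers j (W ⊕ x)) → (∀ {y} → y ∈ Y → Covers b (W ⊕ y)) →
    length X ≡ 2 * t → length Y ≡ 2 * k * t → 0 < k → 0 < t → ⊥
  two-freedoms {W} {b} {X} {Y} ∣W∣ uX uY X∉ Y∉ X≢Y covX covY ∣X∣ ∣Y∣ 0<k 0<t =
    -- Given y, fewer than `t` of the 2t choices of x give colour `b`, so at least t + 1 do not. The
    -- lengths 2t and 2kt are chosen so that |Y| (t + 1) just exceeds |X| k t.
    <-irrefl refl (begin-strict
      2 * t * (k * t) ≡⟨ regroup k t ⟩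
      2 * k * t * t <⟨ *-monoʳ-< (2 * k * t) {{>-nonZero (*-mono-≤ (*-mono-≤ (s≤s (z≤n {1})) 0<k) 0<t)}} (n<1+n t) ⟩
      2 * k * t * suc t ≡⟨ cong (_* suc t) (sym ∣Y∣) ⟩
      length Y * suc t ≤⟨ double-count bad? (k * t) (suc t) X Y bad-X bad-Y ⟩
      length X * (k * t) ≡⟨ cong (_* (k * t)) ∣X∣ ⟩
      2 * t * (k * t) ∎)
    where
    open ≤-Reasoning
    regroup : ∀ k t → 2 * t * (k * t) ≡ 2 * k * t * t
    regroup = solve-∀
    bad? : ∀ x y → Dec (χ (W ⊕ x ⊕ y) ≢ b)
    bad? x y = ¬? (χ (W ⊕ x ⊕ y) Fin.≟ b)
    ∉⊕ : ∀ {x y} → y ∉ˢ W → x ≢ y → y ∉ˢ W ⊕ x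
    ∉⊕ {x} y∉ x≢y y∈ with ∈-⊕⁻ W x y∈
    ... | inj₁ y∈W = y∉ y∈W
    ... | inj₂ y≡x = x≢y (sym y≡x)
    ∣W⊕∣ : ∀ {x} → x ∉ˢ W → ∣ W ⊕ x ∣ ≡ k
    ∣W⊕∣ {x} x∉ = trans (∣p⊕x∣ W x x∉) ∣W∣
    bad-X : ∀ {x} → x ∈ X → # (bad? x) Y ≤ k * t
    bad-X {x} x∈ = subst (λ l → # (bad? x) Y ≤ l * t) (length-allFin k)
      (#-⋃ (bad? x) (λ j y → ¬? (j Fin.≟ b) ×-dec extends? (W ⊕ x) j y) (allFin k) t Y
        (λ {j} _ → #-excluding b (extends? (W ⊕ x)) Y (λ j j≢b →
          <⇒≤ (few-extensions (∣W⊕∣ (X∉ x∈)) (covX x∈ j j≢b) uY)) j)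
        λ {y} y∈ c≢ → _ , ∈-allFin _ , c≢ , ∉⊕ (Y∉ y∈) (X≢Y x∈ y∈) , refl)
    bad-Y : ∀ {y} → y ∈ Y → suc t ≤ # (λ x → bad? x y) X
    bad-Y {y} y∈ = +-cancelʳ-≤ t _ _ (begin
      suc t + t ≡⟨ cong suc (cong (t +_) (sym (+-identityʳ t))) ⟩
      suc (2 * t) ≡⟨ cong suc (sym ∣X∣) ⟩
      suc (length X) ≡⟨ cong suc (sym (#-complement (λ x → bad? x y) X)) ⟩
      suc (# (λ x → bad? x y) X + # (λ x → ¬? (bad? x y)) X) ≡⟨ sym (+-suc _ _) ⟩
      # (λ x → bad? x y) X + suc (# (λ x → ¬? (bad? x y)) X)
        ≤⟨ +-monoʳ-≤ _ (≤-trans (s≤s good≤) (few-extensions (∣W⊕∣ (Y∉ y∈)) (covY y∈) uX)) ⟩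
      # (λ x → bad? x y) X + t ∎)
      where
      good≤ : # (λ x → ¬? (bad? x y)) X ≤ # (extends? (W ⊕ y) b) X
      good≤ = #-mono _ _ X λ {x} x∈ ¬bad → ∉⊕ (X∉ x∈) (X≢Y x∈ y∈ ∘ sym) ,
        trans (cong χ (⊕-comm W y x)) (decidable-stable (_ Fin.≟ b) ¬bad)

-- Private edges

_≟ˢ_ : ∀ {n} (p q : Subset n) → Dec (p ≡ q)
_≟ˢ_ = ≡-dec Bool._≟_

length-filter-≢ : ∀ {A : Set} (_≟_ : (x y : A) → Dec (x ≡ y)) (a : A) {xs} → Unique xs →
  length xs ≤ suc (length (filter (λ x → ¬? (x ≟ a)) xs))
length-filter-≢ _≟_ a {xs} u = unique-⊆-length u sub
  where
  sub : ∀ {x} → x ∈ xs → x ∈ a ∷ filter (λ x → ¬? (x ≟ a)) xs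
  sub {x} x∈ with x ≟ a
  ... | yes refl = here refl
  ... | no x≢ = there (∈-filter⁺ (λ x → ¬? (x ≟ a)) x∈ x≢)

module Private (m k t : ℕ) (χ : Colouring (suc m) k) (2≤m : 2 ≤ m) (t-large : 3 + k ≤ t)
  (i : Fin k) (Q : Subset (suc m)) where

  open Colour m k t χ

  -- An edge of colour i meeting the complement of Q exactly in u and v; such an edge serves
  -- only the pair {u , v}, so the pairs possessing one need not take part in the matching.
  PrivateEdge : V → V → Subset n → Set
  PrivateEdge u v S = u ∉ˢ Q × v ∉ˢ Q × EdgeOn i u v S × (∀ w → w ∈ˢ S → w ∈ˢ Q ⊎ (w ≡ u ⊎ w ≡ v))

  HasPrivate : V → V → Set
  HasPrivate u v = ∃[ S ] PrivateEdge u v S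

  opaque
   hasPrivate? : ∀ u v → Dec (HasPrivate u v)
   hasPrivate? u v = anySubset? λ S → ¬? (u ∈? Q) ×-dec ¬? (v ∈? Q) ×-dec edgeOn? i u v S ×-dec
    Fin.all? λ w → (w ∈? S) →-dec (w ∈? Q ⊎-dec (w Fin.≟ u ⊎-dec w Fin.≟ v))

  private-sym : ∀ {u v} → HasPrivate u v → HasPrivate v u
  private-sym (S , u∉ , v∉ , (s , u∈ , v∈ , c) , only) =
    S , v∉ , u∉ , (s , v∈ , u∈ , c) , λ w w∈ → flip (only w w∈)
    where
    flip : ∀ {w u v} → w ∈ˢ Q ⊎ (w ≡ u ⊎ w ≡ v) → w ∈ˢ Q ⊎ (w ≡ v ⊎ w ≡ u)
    flip (inj₁ a) = inj₁ a
    flip (inj₂ (inj₁ b)) = inj₂ (inj₂ b)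
    flip (inj₂ (inj₂ c)) = inj₂ (inj₁ c)

  -- A private edge may contain many pairs inside `Q`. If such a pair could be a step of the cycle,
  -- an edge reserved elsewhere might be among its candidates.
  Unusable : V → V → Set
  Unusable u v = u ≢ v × (u ∈ˢ Q × v ∈ˢ Q ⊎ (Light i u v × ¬ HasPrivate u v))

  unusable : Graph n
  unusable = record
    { Adj = Unusable
    ; adj? = λ u v → ¬? (u Fin.≟ v) ×-dec
        ((u ∈? Q ×-dec v ∈? Q) ⊎-dec (light? i u v ×-dec ¬? (hasPrivate? u v)))
    ; adj-sym = λ { (u≢v , inj₁ (u∈ , v∈)) → u≢v ∘ sym , inj₁ (v∈ , u∈)
                  ; (u≢v , inj₂ (l , ¬p)) → u≢v ∘ sym , inj₂ (light-sym l , ¬p ∘ private-sym) } }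

  module Realise (v : V → V) (v-inj : ∀ {a b} → v a ≡ v b → a ≡ b)
    (usable : ∀ a → ¬ Unusable (v a) (v (next a))) where

    private? : ∀ a → Dec (HasPrivate (v a) (v (next a)))
    private? a = hasPrivate? (v a) (v (next a))

    φ : Fin n → Subset n
    φ a with private? a
    ... | yes (S , _) = S
    -- A harmless default: `∅` is never an edge, so striking it from the candidates costs nothing.
    ... | no _ = ∅

    φ-private : ∀ a → HasPrivate (v a) (v (next a)) → PrivateEdge (v a) (v (next a)) (φ a)
    φ-private a h with private? a
    ... | yes (S , p) = p
    ... | no ¬h = ⊥-elim (¬h h)

    v≢ : ∀ a → v a ≢ v (next a)
    v≢ a eq with toℕ-next a
    ... | inj₁ p = 1+n≢n (trans (sym p) (cong toℕ (sym (v-inj eq))))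
    ... | inj₂ (p , q) = <-irrefl (trans (sym q) (trans (cong toℕ (sym (v-inj eq))) p)) (≤-trans (s≤s z≤n) 2≤m)

    -- A private edge determines its pair as its vertices outside `Q`. Two positions could then only
    -- traverse that pair in opposite directions, which `next-next≢` excludes.
    φ-injective : ∀ a b → HasPrivate (v a) (v (next a)) → HasPrivate (v b) (v (next b)) →
      φ a ≡ φ b → a ≡ b
    φ-injective a b ha hb eq
      with a∉ , a′∉ , (_ , a∈ , a′∈ , _) , _ ← φ-private a ha
      with _ , _ , _ , only ← φ-private b hb
      with only (v a) (subst (v a ∈ˢ_) eq a∈) | only (v (next a)) (subst (v (next a) ∈ˢ_) eq a′∈)
    ... | inj₁ a∈Q | _ = ⊥-elim (a∉ a∈Q)
    ... | _ | inj₁ a′∈Q = ⊥-elim (a′∉ a′∈Q)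
    ... | inj₂ (inj₁ p) | _ = v-inj p
    ... | inj₂ (inj₂ p) | inj₂ (inj₂ q) = ⊥-elim (v≢ a (trans p (sym q)))
    ... | inj₂ (inj₂ p) | inj₂ (inj₁ q) =
      ⊥-elim (next-next≢ 2≤m b (trans (cong next (sym (v-inj p))) (v-inj q)))

    heavy : ∀ a → ¬ HasPrivate (v a) (v (next a)) →
      ¬ (v a ∈ˢ Q × v (next a) ∈ˢ Q) × t ≤ codegree i (v a) (v (next a))
    heavy a ¬h = (λ q → usable a (v≢ a , inj₁ q)) ,
      ≮⇒≥ λ lt → usable a (v≢ a , inj₂ ((v≢ a , lt) , ¬h))

    edges : Fin n → List (Subset n)
    edges a = filter (edgeOn? i (v a) (v (next a))) (subsets n)

    candidates : Fin n → List (Subset n)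
    candidates a = filter (λ S → ¬? (S ≟ˢ φ (prev a))) (filter (λ S → ¬? (S ≟ˢ φ (next a))) (edges a))

    -- A private edge can only contain the pair of a neighbouring position.
    avoids-private : ∀ a b S → ¬ HasPrivate (v a) (v (next a)) → S ∈ candidates a →
      HasPrivate (v b) (v (next b)) → S ≢ φ b
    avoids-private a b S ¬h S∈ hb eq
      with S∈′ , S≢prev ← ∈-filter⁻ (λ S → ¬? (S ≟ˢ φ (prev a)))
             {xs = filter (λ S → ¬? (S ≟ˢ φ (next a))) (edges a)} S∈
      with S∈″ , S≢next ← ∈-filter⁻ (λ S → ¬? (S ≟ˢ φ (next a))) {xs = edges a} S∈′
      with _ , (_ , a∈ , a′∈ , _) ← ∈-filter⁻ (edgeOn? i (v a) (v (next a))) {xs = subsets n} S∈″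
      with _ , _ , _ , only ← φ-private b hb
      with only (v a) (subst (v a ∈ˢ_) eq a∈) | only (v (next a)) (subst (v (next a) ∈ˢ_) eq a′∈)
    ... | inj₂ (inj₁ p) | _ = ¬h (subst (λ x → HasPrivate (v x) (v (next x))) (sym (v-inj p)) hb)
    ... | inj₂ (inj₂ p) | _ = S≢prev (trans eq (cong φ (trans (sym (prev-next b)) (cong prev (sym (v-inj p))))))
    ... | _ | inj₂ (inj₁ p) = S≢next (trans eq (cong φ (sym (v-inj p))))
    ... | _ | inj₂ (inj₂ p) = ¬h (subst (λ x → HasPrivate (v x) (v (next x)))
            (trans (sym (prev-next b)) (trans (cong prev (sym (v-inj p))) (prev-next a))) hb)
    ... | inj₁ p | inj₁ q = proj₁ (heavy a ¬h) (p , q)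

    open Representatives Fin._≟_ (_≟ˢ_ {n}) candidates (suc k) z<s

    L : List (Fin n)
    L = filter (λ a → ¬? (private? a)) (allFin n)

    L-unique : Unique L
    L-unique = Unique.filter⁺ (λ a → ¬? (private? a)) (Unique.allFin⁺ n)

    many : ∀ {a} → a ∈ L → Unique (candidates a) × suc k ≤ length (candidates a)
    many {a} a∈ = Unique.filter⁺ (λ S → ¬? (S ≟ˢ φ (prev a))) (Unique.filter⁺ (λ S → ¬? (S ≟ˢ φ (next a))) u) ,
      s≤s⁻¹ (s≤s⁻¹ (begin
      3 + k ≤⟨ t-large ⟩
      t ≤⟨ proj₂ (heavy a (proj₂ (∈-filter⁻ (λ a → ¬? (private? a)) {xs = allFin n} a∈))) ⟩
      codegree i (v a) (v (next a)) ≡⟨ #-filter (edgeOn? i (v a) (v (next a))) (subsets n) ⟩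
      length (edges a) ≤⟨ length-filter-≢ _≟ˢ_ (φ (next a)) u ⟩
      suc (length (filter (λ S → ¬? (S ≟ˢ φ (next a))) (edges a)))
        ≤⟨ s≤s (length-filter-≢ _≟ˢ_ (φ (prev a)) (Unique.filter⁺ (λ S → ¬? (S ≟ˢ φ (next a))) u)) ⟩
      2+ (length (candidates a)) ∎))
      where
      open ≤-Reasoning
      u : Unique (edges a)
      u = Unique.filter⁺ (edgeOn? i (v a) (v (next a))) (subsets-unique n)

    candidate-edge : ∀ {a S} → S ∈ candidates a → EdgeOn i (v a) (v (next a)) S
    candidate-edge {a} {S} S∈ = proj₂ (∈-filter⁻ (edgeOn? i (v a) (v (next a))) {xs = subsets n}
      (proj₁ (∈-filter⁻ (λ S → ¬? (S ≟ˢ φ (next a))) {xs = edges a}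
        (proj₁ (∈-filter⁻ (λ S → ¬? (S ≟ˢ φ (prev a)))
          {xs = filter (λ S → ¬? (S ≟ˢ φ (next a))) (edges a)} S∈)))))

    open DecMembership (_≟ˢ_ {n}) using () renaming (_∈?_ to _∈ᴸ?_)

    -- A position `a` with candidate `S` is determined by the vertex `v a` of `S`, and `S` has
    -- `suc k` vertices.
    few : ∀ S → # (λ a → S ∈ᴸ? candidates a) L ≤ suc k
    few S with ∣ S ∣ ≟ suc k
    ... | no ∣S∣ = ≤-trans (≤-reflexive (#-none _ L λ _ S∈ → ∣S∣ (proj₁ (candidate-edge S∈)))) z≤n
    ... | yes ∣S∣ = ≤-trans (#-inj {Q = _∈ˢ S} (λ a → S ∈ᴸ? candidates a) (_∈? S) v {L} {allFin n}
            L-unique (λ _ _ → v-inj)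
            λ _ S∈ → ∈-allFin _ , proj₁ (proj₂ (candidate-edge S∈)))
          (≤-reflexive (trans (sym (∣p∣≡count S)) ∣S∣))

    opaque
     M : Matching L
     M = matching ∅ L L-unique many few

    open Matching M

    ∈L : ∀ a → ¬ HasPrivate (v a) (v (next a)) → a ∈ L
    ∈L a ¬h = ∈-filter⁺ (λ a → ¬? (private? a)) (∈-allFin a) ¬h

    edge : Fin n → Subset n
    edge a with private? a
    ... | yes _ = φ a
    ... | no _ = rep a

    edge-on : ∀ a → EdgeOn i (v a) (v (next a)) (edge a)
    edge-on a with private? a
    ... | yes h = proj₁ (proj₂ (proj₂ (φ-private a h)))
    ... | no ¬h = candidate-edge (candidate (∈L a ¬h))

    edge-injective : ∀ {a b} → edge a ≡ edge b → a ≡ b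
    edge-injective {a} {b} eq with private? a | private? b
    ... | yes ha | yes hb = φ-injective a b ha hb eq
    ... | yes ha | no ¬hb = ⊥-elim (avoids-private b a (rep b) ¬hb (candidate (∈L b ¬hb)) ha (sym eq))
    ... | no ¬ha | yes hb = ⊥-elim (avoids-private a b (rep a) ¬ha (candidate (∈L a ¬ha)) hb eq)
    ... | no ¬ha | no ¬hb = injective (∈L a ¬ha) (∈L b ¬hb) eq

    hamiltonian : MonoHamBergeCycle m (suc k) k χ
    hamiltonian = record
      { colour = i ; vertex = v ; edge = edge ; vertex-inj = v-inj ; edge-inj = edge-injective
      ; edge-size = λ a → proj₁ (edge-on a)
      ; contains-v = λ a → proj₁ (proj₂ (edge-on a))
      ; contains-next = λ a → proj₁ (proj₂ (proj₂ (edge-on a)))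
      ; mono = λ a → proj₂ (proj₂ (proj₂ (edge-on a))) }

  hamiltonian-or-stable : MonoHamBergeCycle m (suc k) k χ ⊎
    ∃[ H ] (∀ {u v} → Graph.Adj H u v → Unusable u v) × Graph.Stable H × ∃[ u ] ∃[ v ] Graph.Adj H u v
  hamiltonian-or-stable with ore _ unusable ≤-refl z<s
  ... | inj₂ stable = inj₂ stable
  ... | inj₁ avoids = inj₁ (let v , v-inj , usable = avoiding-cycle unusable avoids
                            in Realise.hamiltonian v v-inj usable)

-- Stars

module Stars (m k t D : ℕ) (χ : Colouring (suc m) k) (2≤m : 2 ≤ m) (t-large : 3 + k ≤ t)
  (t≤D : t ≤ D) (n-large : k + k * t < suc m) where

  open Colour m k t χ public

  Star : Fin k → V → Set
  Star j x = count (λ y → ¬? (light? j x y)) ≤ D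

  opaque
    star? : ∀ j x → Dec (Star j x)
    star? j x = count (λ y → ¬? (light? j x y)) ≤? D

  Missed : (Fin k → V) → Fin k → V → Set
  Missed x i y = ∃[ j ] j ≢ i × ¬ Light j (x j) y

  opaque
    missed? : ∀ x i y → Dec (Missed x i y)
    missed? x i y = Fin.any? λ j → ¬? (j Fin.≟ i) ×-dec ¬? (light? j (x j) y)

  missed-count : ∀ x i → (∀ j → j ≢ i → Star j (x j)) → count (missed? x i) ≤ k * D
  missed-count x i star = subst (λ l → count (missed? x i) ≤ l * D) (length-allFin k)
    (count-⋃ (missed? x i) (λ j y → ¬? (j Fin.≟ i) ×-dec ¬? (light? j (x j) y)) (allFin k) D
      (λ {j} _ → #-excluding i (λ j y → ¬? (light? j (x j) y)) (allFin n) star j)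
      λ { (j , p) → j , ∈-allFin j , p })

  not-missed : ∀ {x i y} → ¬ Missed x i y → ∀ j → j ≢ i → Light j (x j) y
  not-missed ¬b j j≢i = decidable-stable (light? j _ _) λ ¬l → ¬b (j , j≢i , ¬l)

  -- `K-small` bounds the vertices spoilt for the evader found below. `K-large` says that two
  -- vertices of degree at most `K + k * D` cannot be adjacent in a stable graph.
  module Evasion (K : ℕ) (K-small : K + suc (k * t + K) ≤ D) (K-large : suc ((K + k * D) + (K + k * D)) < n)
    (i : Fin k) (Q : Subset n) (∣Q∣≤K : ∣ Q ∣ ≤ K) where

    open Private m k t χ 2≤m t-large i Q

    -- The common part of reserved edges: `W` has r - 2 vertices, so two vertices outside `Q`
    -- complete it to an edge, and its stars make the colours other than `i` scarce among these
    -- edges.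
    Profile : Subset n → Set
    Profile W = suc ∣ W ∣ ≡ k × W ⊆ˢ Q ×
      Σ[ x ∈ (Fin k → V) ] (∀ j → j ≢ i → x j ∈ˢ W) × (∀ j → j ≢ i → Star j (x j))

    Spoilt : V → V → Set
    Spoilt e z = z ∈ˢ Q ⊎ ¬ Light i e z ⊎ HasPrivate e z

    opaque
      spoilt? : ∀ e z → Dec (Spoilt e z)
      spoilt? e z = z ∈? Q ⊎-dec ¬? (light? i e z) ⊎-dec hasPrivate? e z

    -- For all but `D` vertices z outside `Q`, the pair {e , z} is light in colour `i` and no edge
    -- of colour `i` inside Q ∪ {e , z} contains it.
    Evades : V → Set
    Evades e = e ∉ˢ Q × count (spoilt? e) ≤ D

    evades-star : ∀ {e} → Evades e → Star i e
    evades-star (_ , le) = ≤-trans (count-mono _ _ (inj₂ ∘ inj₁)) le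

    module _ (H : Graph n) (H⊆ : ∀ {u v} → Graph.Adj H u v → Unusable u v) where

      open Graph H

      light-outside : ∀ {u v} → u ∉ˢ Q → Adj u v → Light i u v × ¬ HasPrivate u v
      light-outside u∉ a with H⊆ a
      ... | _ , inj₁ (u∈ , _) = ⊥-elim (u∉ u∈)
      ... | _ , inj₂ l = l

      in-Q≤K : count (_∈? Q) ≤ K
      in-Q≤K = ≤-trans (≤-reflexive (sym (∣p∣≡count Q))) ∣Q∣≤K

      -- If z is a neighbour outside `Q`, the edge `W ⊕ y ⊕ z` does not have colour `i`, for it
      -- would be private to {y , z}. Every other colour is covered by `W ⊕ y` and accounts for at
      -- most `t` such z.
      degree-good : ∀ {W} → (p : Profile W) → ∀ {y} → y ∉ˢ Q →
        ¬ Missed (proj₁ (proj₂ (proj₂ p))) i y → degree y ≤ K + k * t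
      degree-good {W} (∣W∣ , W⊆Q , x , x∈ , star) {y} y∉ ¬missed = begin
        degree y ≤⟨ count-∪ (adj? y) (_∈? Q) other? split ⟩
        count (_∈? Q) + count other? ≤⟨ +-mono-≤ in-Q≤K others ⟩
        K + k * t ∎
        where
        open ≤-Reasoning
        y∉W : y ∉ˢ W
        y∉W = y∉ ∘ W⊆Q
        ∣W⊕y∣ : ∣ W ⊕ y ∣ ≡ k
        ∣W⊕y∣ = trans (∣p⊕x∣ W y y∉W) ∣W∣
        other? : ∀ z → Dec (∃[ j ] j ≢ i × Extends (W ⊕ y) j z)
        other? z = Fin.any? λ j → ¬? (j Fin.≟ i) ×-dec extends? (W ⊕ y) j z
        others : count other? ≤ k * t
        others = subst (λ l → count other? ≤ l * t) (length-allFin k)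
          (count-⋃ other? (λ j z → ¬? (j Fin.≟ i) ×-dec extends? (W ⊕ y) j z) (allFin k) t
            (λ {j} _ → #-excluding i (extends? (W ⊕ y)) (allFin n) (λ j j≢i → <⇒≤ (few-extensions ∣W⊕y∣
              (x j , y , p⊆p⊕x W y (x∈ j j≢i) , x∈p⊕x W y , not-missed ¬missed j j≢i) (Unique.allFin⁺ n))) j)
            λ { (j , p) → j , ∈-allFin j , p })
        split : ∀ {z} → Adj y z → z ∈ˢ Q ⊎ ∃[ j ] j ≢ i × Extends (W ⊕ y) j z
        split {z} a with z ∈? Q
        ... | yes z∈ = inj₁ z∈
        ... | no z∉ = inj₂ (χ (W ⊕ y ⊕ z) , colour≢ , z∉W⊕y , refl)
          where
          z∉W⊕y : z ∉ˢ W ⊕ y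
          z∉W⊕y z∈ with ∈-⊕⁻ W y z∈
          ... | inj₁ z∈W = z∉ (W⊆Q z∈W)
          ... | inj₂ z≡y = proj₁ (proj₁ (light-outside y∉ a)) (sym z≡y)
          only : ∀ w → w ∈ˢ W ⊕ y ⊕ z → w ∈ˢ Q ⊎ (w ≡ y ⊎ w ≡ z)
          only w w∈ with ∈-⊕⁻ (W ⊕ y) z w∈
          ... | inj₂ w≡z = inj₂ (inj₂ w≡z)
          ... | inj₁ w∈′ with ∈-⊕⁻ W y w∈′
          ...   | inj₁ w∈W = inj₁ (W⊆Q w∈W)
          ...   | inj₂ w≡y = inj₂ (inj₁ w≡y)
          colour≢ : χ (W ⊕ y ⊕ z) ≢ i
          colour≢ c = proj₂ (light-outside y∉ a) (W ⊕ y ⊕ z , y∉ , z∉ ,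
            (trans (∣p⊕x∣ (W ⊕ y) z z∉W⊕y) (cong suc ∣W⊕y∣) ,
             p⊆p⊕x (W ⊕ y) z (x∈p⊕x W y) , x∈p⊕x (W ⊕ y) z , c) , only)

      -- A neighbour z outside `Q` is light with `q` in colour `i`; were it not missed, `W ⊕ z`
      -- would cover all colours.
      degree-Q : ∀ {q W} → q ∈ˢ W → Profile W → q ∈ˢ Q → degree q ≤ K + k * D
      degree-Q {q} {W} q∈W (∣W∣ , W⊆Q , x , x∈ , star) q∈ = begin
        degree q ≤⟨ count-∪ (adj? q) (_∈? Q) (missed? x i) split ⟩
        count (_∈? Q) + count (missed? x i) ≤⟨ +-mono-≤ in-Q≤K (missed-count x i star) ⟩
        K + k * D ∎
        where
        open ≤-Reasoning
        split : ∀ {z} → Adj q z → z ∈ˢ Q ⊎ Missed x i z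
        split {z} a with z ∈? Q | missed? x i z
        ... | yes z∈ | _ = inj₁ z∈
        ... | _ | yes b = inj₂ b
        ... | no z∉ | no ¬b = ⊥-elim (not-all-covered n-large {W ⊕ z}
            (≤-trans (∣p⊕x∣≤ W z) (≤-reflexive ∣W∣)) covered)
          where
          covered : ∀ j → Covers j (W ⊕ z)
          covered j with j Fin.≟ i
          ... | yes refl = z , q , x∈p⊕x W z , p⊆p⊕x W z q∈W , proj₁ (light-outside z∉ (adj-sym a))
          ... | no j≢i = x j , z , p⊆p⊕x W z (x∈ j j≢i) , x∈p⊕x W z , not-missed ¬b j j≢i

    -- Vertices without good neighbours have degree at most α, so they cannot be adjacent in `H`,
    -- and some edge of `H` has a good end y. Its degree is at most β, so by stability the other end
    -- e is adjacent to all but β + 1 vertices. By `degree-Q` such an e lies outside `Q`, where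
    -- adjacency means light without a private edge.
    find-evader : (∃[ q ] q ∈ˢ Q) → (∀ q → q ∈ˢ Q → ∃[ W ] q ∈ˢ W × Profile W) →
      MonoHamBergeCycle m (suc k) k χ ⊎ ∃[ e ] Evades e
    find-evader (q₀ , q₀∈) profile with hamiltonian-or-stable
    ... | inj₁ ham = inj₁ ham
    ... | inj₂ (H , H⊆ , stable , u , v , uv) = inj₂ evader
      where
      open Graph H
      W₀ = proj₁ (profile q₀ q₀∈)
      p₀ = proj₂ (proj₂ (profile q₀ q₀∈))
      x₀ = proj₁ (proj₂ (proj₂ p₀))
      α = K + k * D
      β = K + k * t
      β≤α : β ≤ α
      β≤α = +-monoʳ-≤ K (*-monoʳ-≤ k t≤D)
      Good : V → Set
      Good y = y ∉ˢ Q × ¬ Missed x₀ i y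
      good? : ∀ y → Dec (Good y)
      good? y = ¬? (y ∈? Q) ×-dec ¬? (missed? x₀ i y)
      too-small : ∀ {a b} → Adj a b → degree a ≤ α → degree b ≤ α → ⊥
      too-small {a} {b} ab da db = <-irrefl refl (≤-trans (s≤s (stable ab))
        (≤-trans (s≤s (s≤s (+-mono-≤ da db))) K-large))
      from-good : ∀ {y e} → Adj y e → Good y → ∃[ e ] Evades e
      from-good {y} {e} ye (y∉ , ¬b) = e , e∉ , (begin
        count (spoilt? e) ≤⟨ count-∪ (spoilt? e) (_∈? Q) (λ z → ¬? (adj? e z)) split ⟩
        count (_∈? Q) + count (λ z → ¬? (adj? e z)) ≤⟨ +-mono-≤ (in-Q≤K H H⊆) rest ⟩
        K + suc (K + k * t) ≡⟨ cong (λ l → K + suc l) (+-comm K (k * t)) ⟩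
        K + suc (k * t + K) ≤⟨ K-small ⟩
        D ∎)
        where
        open ≤-Reasoning
        dy : degree y ≤ β
        dy = degree-good H H⊆ p₀ y∉ ¬b
        e∉ : e ∉ˢ Q
        e∉ e∈ = too-small ye (≤-trans dy β≤α)
          (degree-Q H H⊆ (proj₁ (proj₂ (profile e e∈))) (proj₂ (proj₂ (profile e e∈))) e∈)
        rest : count (λ z → ¬? (adj? e z)) ≤ suc β
        rest = +-cancelˡ-≤ (degree e) _ _ (begin
          degree e + count (λ z → ¬? (adj? e z)) ≡⟨ count-total (adj? e) ⟩
          n ≤⟨ stable ye ⟩
          suc (degree y + degree e) ≤⟨ s≤s (+-monoˡ-≤ (degree e) dy) ⟩
          suc (β + degree e) ≡⟨ +-comm (suc β) (degree e) ⟩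
          degree e + suc β ∎)
        split : ∀ {z} → Spoilt e z → z ∈ˢ Q ⊎ ¬ Adj e z
        split (inj₁ z∈) = inj₁ z∈
        split (inj₂ (inj₁ ¬l)) = inj₂ λ a → ¬l (proj₁ (light-outside H H⊆ e∉ a))
        split (inj₂ (inj₂ h)) = inj₂ λ a → proj₂ (light-outside H H⊆ e∉ a) h
      degree-bad : ∀ a → ¬ (∃[ w ] Adj a w × Good w) → degree a ≤ α
      degree-bad a none = ≤-trans (count-∪ (adj? a) (_∈? Q) (missed? x₀ i) split)
        (+-mono-≤ (in-Q≤K H H⊆) (missed-count x₀ i (proj₂ (proj₂ (proj₂ (proj₂ p₀))))))
        where
        split : ∀ {z} → Adj a z → z ∈ˢ Q ⊎ Missed x₀ i z
        split {z} az with z ∈? Q | missed? x₀ i z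
        ... | yes z∈ | _ = inj₁ z∈
        ... | _ | yes b = inj₂ b
        ... | no z∉ | no ¬b = ⊥-elim (none (z , az , z∉ , ¬b))
      evader : ∃[ e ] Evades e
      evader with Fin.any? (λ w → adj? u w ×-dec good? w) | Fin.any? (λ w → adj? v w ×-dec good? w)
      ... | yes (w , uw , g) | _ = from-good (adj-sym uw) g
      ... | _ | yes (w , vw , g) = from-good (adj-sym vw) g
      ... | no ¬u | no ¬v = ⊥-elim (too-small uv (degree-bad u ¬u) (degree-bad v ¬v))

-- Chains of colours

maximal : ∀ {n} (f : Fin (suc n) → ℕ) → ∃[ i ] (∀ j → f j ≤ f i)
maximal {zero} f = zero , λ { zero → ≤-refl }
maximal {suc n} f with i , max ← maximal (f ∘ suc) with ≤-total (f zero) (f (suc i))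
... | inj₁ le = suc i , λ { zero → le ; (suc j) → max j }
... | inj₂ ge = zero , λ { zero → ≤-refl ; (suc j) → ≤-trans (max j) ge }

extract-max : ∀ {A : Set} (f : A → ℕ) x xs →
  ∃[ a ] ∃[ as ] x ∷ xs ↭ a ∷ as × (∀ {b} → b ∈ as → f b ≤ f a)
extract-max f x [] = x , [] , ↭-refl , λ ()
extract-max f x (y ∷ ys) with a , as , p , max ← extract-max f y ys with ≤-total (f x) (f a)
... | inj₁ le = a , x ∷ as   , ↭-trans (prep x p) (swap x a ↭-refl) ,
  λ { (here refl) → le ; (there b∈) → max b∈ }
... | inj₂ ge = x , y ∷ ys , ↭-refl , λ b∈ → below (∈-resp-↭ p b∈)
  where
  below : ∀ {b} → b ∈ a ∷ as → f b ≤ f x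
  below (here refl) = ge
  below (there b∈) = ≤-trans (max b∈) ge

module Stability {n′ : ℕ} (H : Graph (suc n′)) (stable : Graph.Stable H)
  (irreflexive : ∀ {v} → ¬ Graph.Adj H v v) (nonempty : ∃[ u ] ∃[ v ] Graph.Adj H u v) where

  open Graph H

  n₀ = suc n′

  centre : Fin n₀
  centre = proj₁ (maximal degree)

  opaque
    κ : ℕ
    κ = count (λ v → ¬? (adj? centre v))

    κ-count : κ ≡ count (λ v → ¬? (adj? centre v))
    κ-count = refl

  centre-max : ∀ v → degree v ≤ degree centre
  centre-max = proj₂ (maximal degree)

  Active : Fin n₀ → Set
  Active v = ∃[ u ] Adj v u

  active? : ∀ v → Dec (Active v)
  active? v = Fin.any? (adj? v)

  -- Stability at an edge vu gives n - 1 ≤ degree v + degree u, and degree u is at most the degree n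
  -- - κ of the centre.
  κ≤ : ∀ {v} → Active v → κ ≤ suc (degree v)
  κ≤ {v} (u , a) = +-cancelˡ-≤ (degree centre) _ _ (begin
    degree centre + κ ≡⟨ trans (cong (degree centre +_) κ-count) (count-total (adj? centre)) ⟩
    n₀ ≤⟨ stable a ⟩
    suc (degree v + degree u) ≤⟨ s≤s (+-monoʳ-≤ (degree v) (centre-max u)) ⟩
    suc (degree v) + degree centre ≡⟨ +-comm (suc (degree v)) (degree centre) ⟩
    degree centre + suc (degree v) ∎)
    where open ≤-Reasoning

  centre-active : Active centre
  centre-active =
    let u , v , a = nonempty
        w , _ , cw = #-exists (adj? centre) (allFin n₀)
          (≤-trans (unique-⊆-# (adj? u) ([] ∷ []) λ { (here refl) → ∈-allFin v , a }) (centre-max u))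
    in w , cw

  -- An inactive vertex is not adjacent to the centre. The inequality is strict because the centre,
  -- though active, is not adjacent to itself.
  inactive< : count (λ v → ¬? (active? v)) < κ
  inactive< = ≤-trans (#-strict (λ v → ¬? (active? v)) (λ v → ¬? (adj? centre v))
    (λ ¬a c → ¬a (centre , adj-sym c)) (∈-allFin centre) irreflexive (λ ¬a → ¬a centre-active))
    (≤-reflexive (sym κ-count))

count-∈ : ∀ {n} (xs : List (Fin n)) (_∈ᴸ?_ : ∀ x (ys : List (Fin n)) → Dec (x ∈ ys)) →
  count (λ x → x ∈ᴸ? xs) ≤ length xs
count-∈ {n} xs _∈ᴸ?_ = ≤-trans (≤-reflexive (#-filter (λ x → x ∈ᴸ? xs) (allFin n)))
  (unique-⊆-length (Unique.filter⁺ (λ x → x ∈ᴸ? xs) (Unique.allFin⁺ n))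
    λ x∈ → proj₂ (∈-filter⁻ (λ x → x ∈ᴸ? xs) {xs = allFin n} x∈))

module Chains (m k t D B : ℕ) (χ : Colouring (suc m) (suc k)) (2≤m : 2 ≤ m) (t-large : 4 + k ≤ t)
  (t≤D : t ≤ D) (n-large : suc k + suc k * t < suc m)
  (B-large : k + 2 * t + 2 * suc k * t ≤ B) (D-large : k + suc k * B + 2 * t ≤ D)
  (H : Fin (suc k) → Graph (suc m))
  (H-light : ∀ i {u v} → Graph.Adj (H i) u v → Stars.Light m (suc k) t D χ 2≤m t-large t≤D n-large i u v)
  (H-stable : ∀ i → Graph.Stable (H i))
  (H-nonempty : ∀ i → ∃[ u ] ∃[ v ] Graph.Adj (H i) u v) where

  open Stars m (suc k) t D χ 2≤m t-large t≤D n-large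
  open module G i = Graph (H i)
  open module S i = Stability (H i) (H-stable i) (λ a → proj₁ (H-light i a) refl) (H-nonempty i)
    hiding (n₀)

  Colour′ = Fin (suc k)

  -- The closed neighbourhood of `y` in colour `a` has at least `κ a` ≥ `κ b` vertices, while fewer
  -- than `κ b` vertices are inactive in colour `b`.
  link : ∀ {a b y} → κ b ≤ κ a → Active a y → ∃[ z ] Active b z × (z ≡ y ⊎ Adj a y z)
  link {a} {b} {y} le act with Fin.any? (λ z → active? b z ×-dec (z Fin.≟ y ⊎-dec adj? a y z))
  ... | yes found = found
  ... | no none = ⊥-elim (<-irrefl refl (begin-strict
    count near? ≤⟨ count-mono near? (λ z → ¬? (active? b z)) (λ {z} nr act → none (z , act , nr)) ⟩
    count (λ z → ¬? (active? b z)) <⟨ inactive< b ⟩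
    κ b ≤⟨ le ⟩
    κ a ≤⟨ κ≤ a act ⟩
    suc (degree a y) ≤⟨ #-strict (adj? a y) near? inj₂ (∈-allFin y) (inj₁ refl) (λ ayy → proj₁ (H-light a ayy) refl) ⟩
    count near? ∎))
    where
    open ≤-Reasoning
    near? : ∀ z → Dec (z ≡ y ⊎ Adj a y z)
    near? z = z Fin.≟ y ⊎-dec adj? a y z

  -- Consecutive colours share a vertex, so one vertex per colour suffices. In colour `last` only
  -- `end` is present: its partner is left to range over a long list.
  record Chain (L : List Colour′) (y : V) : Set where
    field
      path    : List V
      start∈  : y ∈ path
      short   : length path ≤ length L
      last    : Colour′
      last∈   : last ∈ L
      end     : V
      end∈    : end ∈ path
      active  : Active last end
      covered : ∀ {j} → j ∈ L → j ≢ last → ∃[ u ] ∃[ v ] u ∈ path × v ∈ path × Adj j u v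

  -- Listing the colours by decreasing κ, each closed neighbourhood of a vertex active in one
  -- colour contains a vertex active in the next.
  chain : ∀ N x xs → length xs ≡ N → ∃[ f ] f ∈ x ∷ xs × (∀ {y} → Active f y → Chain (x ∷ xs) y)
  chain zero x [] _ = x , here refl , λ {y} act → record
    { path = y ∷ [] ; start∈ = here refl ; short = ≤-refl ; last = x ; last∈ = here refl ; end = y
    ; end∈ = here refl ; active = act ; covered = λ { (here refl) x≢x → ⊥-elim (x≢x refl) } }
  chain (suc N) x xs len with extract-max κ x xs
  ... | a , [] , p , _ with () ← trans (sym len) (suc-injective (↭-length p))
  ... | a , a′ ∷ as , p , max
    with f , f∈ , continue ← chain N a′ as
           (suc-injective (trans (suc-injective (sym (↭-length p))) len)) =
    a , ∈-resp-↭ (↭-sym p) (here refl) , go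
    where
    go : ∀ {y} → Active a y → Chain (x ∷ xs) y
    go {y} (u , yu) with link (max f∈) (u , yu)
    -- Here `y` itself is active in the next colour, so the one new vertex is free to be a neighbour
    -- of `y`, which covers `a`.
    ... | z , z-act , inj₁ refl = record
      { path = u ∷ path ; start∈ = there start∈
      ; short = ≤-trans (s≤s short) (≤-reflexive (sym (↭-length p)))
      ; last = last ; last∈ = ∈-resp-↭ (↭-sym p) (there last∈) ; end = end ; end∈ = there end∈
      ; active = active
      ; covered = λ j∈ j≢ → cov (∈-resp-↭ p j∈) j≢ }
      where
      open Chain (continue z-act)
      cov : ∀ {j} → j ∈ a ∷ a′ ∷ as → j ≢ last → ∃[ v ] ∃[ w ] v ∈ u ∷ path × w ∈ u ∷ path × Adj j v w
      cov (here refl) _ = y , u , there start∈ , here refl , yu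
      cov (there j∈) j≢ = let v , w , v∈ , w∈ , vw = covered j∈ j≢ in v , w , there v∈ , there w∈ , vw
    ... | z , z-act , inj₂ yz = record
      { path = y ∷ path ; start∈ = here refl
      ; short = ≤-trans (s≤s short) (≤-reflexive (sym (↭-length p)))
      ; last = last ; last∈ = ∈-resp-↭ (↭-sym p) (there last∈) ; end = end ; end∈ = there end∈
      ; active = active
      ; covered = λ j∈ j≢ → cov (∈-resp-↭ p j∈) j≢ }
      where
      open Chain (continue z-act)
      cov : ∀ {j} → j ∈ a ∷ a′ ∷ as → j ≢ last → ∃[ v ] ∃[ w ] v ∈ y ∷ path × w ∈ y ∷ path × Adj j v w
      cov (here refl) _ = y , z , here refl , there start∈ , yz
      cov (there j∈) j≢ = let v , w , v∈ , w∈ , vw = covered j∈ j≢ in v , w , there v∈ , there w∈ , vw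

  -- Linking starts at the centre of the colour with larger κ; a neighbour of the centre is active
  -- in that colour as well.
  common-active : ∀ a f → ∃[ y ] Active a y × Active f y
  common-active a f with ≤-total (κ f) (κ a)
  ... | inj₁ le with link le (centre-active a)
  ...   | z , act , inj₁ refl = z , centre-active a , act
  ...   | z , act , inj₂ cz = z , (_ , adj-sym a cz) , act
  common-active a f | inj₂ ge with link ge (centre-active f)
  ...   | z , act , inj₁ refl = z , act , centre-active f
  ...   | z , act , inj₂ cz = z , act , (_ , adj-sym f cz)

  open DecMembership (Fin._≟_ {n}) using () renaming (_∈?_ to _∈ᴸ?_)

  -- The lists for `two-freedoms`: at least `D` neighbours of `y₁` in colour `a`, and at least `B`
  -- neighbours of `end` in colour `last`. A vertex x of the first completes `a` and, because small
  -- centres miss few vertices, all colours in `smalls`; the path covers the remaining ones but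
  -- `last`, which is completed by the second list.
  module TwoBig (a b : Colour′) (a≢b : a ≢ b) (D<κ : D < κ a) (B<κ : B < κ b) where

    big? : ∀ j → Dec (j ≢ a × B < κ j)
    big? j = ¬? (j Fin.≟ a) ×-dec B <? κ j

    small? : ∀ j → Dec (j ≢ a × ¬ B < κ j)
    small? j = ¬? (j Fin.≟ a) ×-dec ¬? (B <? κ j)

    opaque
      bigs smalls : List Colour′
      bigs = filter big? (allFin (suc k))
      smalls = filter small? (allFin (suc k))

      ∈-bigs⁺ : ∀ {j} → j ≢ a × B < κ j → j ∈ bigs
      ∈-bigs⁺ = ∈-filter⁺ big? (∈-allFin _)

      ∈-bigs⁻ : ∀ {j} → j ∈ bigs → j ≢ a × B < κ j
      ∈-bigs⁻ j∈ = proj₂ (∈-filter⁻ big? {xs = allFin (suc k)} j∈)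

      ∈-smalls⁺ : ∀ {j} → j ≢ a × ¬ B < κ j → j ∈ smalls
      ∈-smalls⁺ = ∈-filter⁺ small? (∈-allFin _)

      ∈-smalls⁻ : ∀ {j} → j ∈ smalls → j ≢ a × ¬ B < κ j
      ∈-smalls⁻ j∈ = proj₂ (∈-filter⁻ small? {xs = allFin (suc k)} j∈)

      bigs-unique : Unique bigs
      bigs-unique = Unique.filter⁺ big? (Unique.allFin⁺ (suc k))

      smalls-unique : Unique smalls
      smalls-unique = Unique.filter⁺ small? (Unique.allFin⁺ (suc k))

    split-size : length bigs + length smalls ≤ k
    split-size = s≤s⁻¹ (≤-trans (≤-reflexive (cong suc (sym (length-++ bigs))))
      (≤-trans (unique-⊆-length unique (λ {j} _ → ∈-allFin j)) (≤-reflexive (length-allFin (suc k)))))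
      where
      a∉ : ∀ {j} → j ∈ bigs ++ smalls → a ≢ j
      a∉ {j} j∈ refl with ∈-++⁻ bigs j∈
      ... | inj₁ p = proj₁ (∈-bigs⁻ p) refl
      ... | inj₂ p = proj₁ (∈-smalls⁻ p) refl
      unique : Unique (a ∷ bigs ++ smalls)
      unique = All.tabulate a∉ ∷ Unique.++⁺ bigs-unique smalls-unique
        λ (p , q) → proj₂ (∈-smalls⁻ q) (proj₂ (∈-bigs⁻ p))

    opaque
      start : ∃[ y ] Active a y × Chain bigs y
      start =
        let f , continue = nonempty bigs (∈-bigs⁺ (a≢b ∘ sym , B<κ))
            y , a-active , f-active = common-active a f
        in y , a-active , continue f-active
        where
        nonempty : ∀ L → b ∈ L → ∃[ f ] (∀ {y} → Active f y → Chain L y)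
        nonempty (x ∷ xs) _ = let f , _ , c = chain (length xs) x xs refl in f , c

    y₁ : V
    y₁ = proj₁ start

    y₁-active : Active a y₁
    y₁-active = proj₁ (proj₂ start)

    open Chain (proj₂ (proj₂ start))

    core : List V
    core = path ++ map centre smalls

    opaque
     padded : ∃[ W ] fromList core ⊆ˢ W × ∣ W ∣ ≡ k
     padded = pad k (fromList core) (begin
       ∣ fromList core ∣ ≤⟨ ∣fromList∣≤ core ⟩
       length core ≡⟨ trans (length-++ path) (cong (length path +_) (length-map centre smalls)) ⟩
       length path + length smalls ≤⟨ +-monoˡ-≤ (length smalls) short ⟩
       length bigs + length smalls ≤⟨ split-size ⟩
       k ∎) (≤-trans (≤-trans (n≤1+n k) (m≤m+n (suc k) _)) (<⇒≤ n-large))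
       where open ≤-Reasoning

    W = proj₁ padded

    ∣W∣ : ∣ W ∣ ≡ k
    ∣W∣ = proj₂ (proj₂ padded)

    ∈W : ∀ {v} → v ∈ core → v ∈ˢ W
    ∈W = proj₁ (proj₂ padded) ∘ ∈-fromList

    in-W : count (_∈? W) ≡ k
    in-W = trans (sym (∣p∣≡count W)) ∣W∣

    Adjacent-to-centres : V → Set
    Adjacent-to-centres x = All (λ j → Adj j (centre j) x) smalls

    X? : ∀ x → Dec (Adj a y₁ x × x ∉ˢ W × Adjacent-to-centres x)
    X? x = adj? a y₁ x ×-dec ¬? (x ∈? W) ×-dec all? (λ j → adj? j (centre j) x) smalls

    X-large : 2 * t ≤ count X?
    X-large = +-cancelˡ-≤ (k + suc k * B) _ _ (begin
      -- `D` pays for `W`, for at most `B` non-neighbours of each small centre, and for the list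
      -- `X`.
      k + suc k * B + 2 * t ≤⟨ D-large ⟩
      D ≤⟨ s≤s⁻¹ (≤-trans D<κ (κ≤ a y₁-active)) ⟩
      degree a y₁ ≤⟨ count-∪ (adj? a y₁) (λ x → x ∈? W ⊎-dec far? x) X? split ⟩
      count (λ x → x ∈? W ⊎-dec far? x) + count X?
        ≤⟨ +-monoˡ-≤ (count X?) (≤-trans (count-∪ _ (_∈? W) far? id) (+-mono-≤ (≤-reflexive in-W) far≤)) ⟩
      k + suc k * B + count X? ∎)
      where
      open ≤-Reasoning
      far? : ∀ x → Dec (∃[ j ] (j ≢ a × ¬ B < κ j) × ¬ Adj j (centre j) x)
      far? x = Fin.any? λ j → small? j ×-dec ¬? (adj? j (centre j) x)
      far≤ : count far? ≤ suc k * B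
      far≤ = ≤-trans (count-⋃ far? (λ j x → ¬? (adj? j (centre j) x)) smalls B
        (λ {j} j∈ → ≤-trans (≤-reflexive (sym (κ-count j)))
          (≮⇒≥ (proj₂ (∈-smalls⁻ j∈))))
        λ { (j , s , p) → j , ∈-smalls⁺ s , p })
        (*-monoˡ-≤ B (≤-trans (m≤n+m _ (length bigs)) (≤-trans split-size (n≤1+n k))))
      split : ∀ {x} → Adj a y₁ x → (x ∈ˢ W ⊎ ∃[ j ] (j ≢ a × ¬ B < κ j) × ¬ Adj j (centre j) x) ⊎
        (Adj a y₁ x × x ∉ˢ W × Adjacent-to-centres x)
      split {x} ax with x ∈? W | far? x
      ... | yes x∈ | _ = inj₁ (inj₁ x∈)
      ... | _ | yes f = inj₁ (inj₂ f)
      ... | no x∉ | no ¬f = inj₂ (ax , x∉ , All.tabulate λ {j} j∈ → decidable-stable (adj? j (centre j) x)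
        λ ¬c → ¬f (j , ∈-smalls⁻ j∈ , ¬c))

    opaque
     X-family : ∃[ zs ] length zs ≡ 2 * t × Unique zs ×
       (∀ {z} → z ∈ zs → z ∈ allFin n × Adj a y₁ z × z ∉ˢ W × Adjacent-to-centres z)
     X-family = subfamily X? (2 * t) (Unique.allFin⁺ n) X-large

    X = proj₁ X-family

    ∣X∣ : length X ≡ 2 * t
    ∣X∣ = proj₁ (proj₂ X-family)

    X-good : ∀ {x} → x ∈ X → Adj a y₁ x × x ∉ˢ W × Adjacent-to-centres x
    X-good x∈ = proj₂ (proj₂ (proj₂ (proj₂ X-family)) x∈)

    Y? : ∀ y → Dec (Adj last end y × y ∉ˢ W × y ∉ X)
    Y? y = adj? last end y ×-dec ¬? (y ∈? W) ×-dec ¬? (y ∈ᴸ? X)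

    Y-large : 2 * suc k * t ≤ count Y?
    Y-large = +-cancelˡ-≤ (k + 2 * t) _ _ (begin
      -- `B` pays for `W`, for `X` and for the list `Y`.
      k + 2 * t + 2 * suc k * t ≤⟨ B-large ⟩
      B ≤⟨ s≤s⁻¹ (≤-trans (proj₂ (∈-bigs⁻ last∈)) (κ≤ last active)) ⟩
      degree last end ≤⟨ count-∪ (adj? last end) (λ y → y ∈? W ⊎-dec y ∈ᴸ? X) Y? split ⟩
      count (λ y → y ∈? W ⊎-dec y ∈ᴸ? X) + count Y?
        ≤⟨ +-monoˡ-≤ (count Y?) (≤-trans (count-∪ _ (_∈? W) (_∈ᴸ? X) id)
             (+-mono-≤ (≤-reflexive in-W) (≤-trans (count-∈ X _∈ᴸ?_) (≤-reflexive ∣X∣)))) ⟩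
      k + 2 * t + count Y? ∎)
      where
      open ≤-Reasoning
      split : ∀ {y} → Adj last end y → (y ∈ˢ W ⊎ y ∈ X) ⊎ (Adj last end y × y ∉ˢ W × y ∉ X)
      split {y} ly with y ∈? W | y ∈ᴸ? X
      ... | yes y∈ | _ = inj₁ (inj₁ y∈)
      ... | _ | yes y∈ = inj₁ (inj₂ y∈)
      ... | no y∉ | no y∉X = inj₂ (ly , y∉ , y∉X)

    opaque
     Y-family : ∃[ zs ] length zs ≡ 2 * suc k * t × Unique zs ×
       (∀ {z} → z ∈ zs → z ∈ allFin n × Adj last end z × z ∉ˢ W × z ∉ X)
     Y-family = subfamily Y? (2 * suc k * t) (Unique.allFin⁺ n) Y-large

    Y = proj₁ Y-family

    Y-good : ∀ {y} → y ∈ Y → Adj last end y × y ∉ˢ W × y ∉ X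
    Y-good y∈ = proj₂ (proj₂ (proj₂ (proj₂ Y-family)) y∈)

    contradiction : ⊥
    contradiction = two-freedoms {W} {last} {X} {Y} (cong suc ∣W∣)
      (proj₁ (proj₂ (proj₂ X-family))) (proj₁ (proj₂ (proj₂ Y-family)))
      (λ x∈ → proj₁ (proj₂ (X-good x∈))) (λ y∈ → proj₁ (proj₂ (Y-good y∈)))
      (λ { x∈ y∈ refl → proj₂ (proj₂ (Y-good y∈)) x∈ })
      covX (λ {y} y∈ → end , y , p⊆p⊕x W y (∈W (∈-++⁺ˡ end∈)) , x∈p⊕x W y , H-light last (proj₁ (Y-good y∈)))
      ∣X∣ (proj₁ (proj₂ Y-family)) z<s (≤-trans (s≤s z≤n) t-large)
      where
      covX : ∀ {x} → x ∈ X → ∀ j → j ≢ last → Covers j (W ⊕ x)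
      covX {x} x∈ j j≢ with j Fin.≟ a | B <? κ j
      ... | yes refl | _ = y₁ , x , p⊆p⊕x W x (∈W (∈-++⁺ˡ start∈)) , x∈p⊕x W x , H-light j (proj₁ (X-good x∈))
      ... | no j≢a | yes big =
        let u , v , u∈ , v∈ , uv = covered (∈-bigs⁺ (j≢a , big)) j≢
        in u , v , p⊆p⊕x W x (∈W (∈-++⁺ˡ u∈)) , p⊆p⊕x W x (∈W (∈-++⁺ˡ v∈)) , H-light j uv
      ... | no j≢a | no ¬big =
        let j∈ = ∈-smalls⁺ (j≢a , ¬big)
        in centre j , x , p⊆p⊕x W x (∈W (∈-++⁺ʳ path (∈-map⁺ centre j∈))) , x∈p⊕x W x ,
           H-light j (All.lookup (proj₂ (proj₂ (X-good x∈))) j∈)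

  centre-star : ∀ j → κ j ≤ D → Star j (centre j)
  centre-star j le = ≤-trans (count-mono _ (λ v → ¬? (adj? j (centre j) v)) λ ¬l a → ¬l (H-light j a))
    (≤-trans (≤-reflexive (sym (κ-count j))) le)

  -- As soon as one κ exceeds `D`, no other exceeds `B`, by `TwoBig`; and a centre with κ at most
  -- `D` is a star.
  stars-but-one : ∃[ a ] (∀ j → j ≢ a → ∃[ x ] Star j x)
  stars-but-one with Fin.any? (λ a → D <? κ a)
  ... | no none = zero , λ j _ → centre j , centre-star j (≮⇒≥ λ lt → none (j , lt))
  ... | yes (a , D<κ) = a , λ j j≢a → centre j , centre-star j (≤-trans
      (≮⇒≥ λ B<κ → TwoBig.contradiction a j (j≢a ∘ sym) D<κ B<κ) B≤D)
    where
    B≤D : B ≤ D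
    B≤D = ≤-trans (≤-trans (m≤m+n B (k * B)) (≤-trans (m≤n+m _ k) (m≤m+n _ (2 * t)))) D-large

-- Evaders for all colours

opaque
  comprehension : ∀ {n} {P : Fin n → Set} → (∀ x → Dec (P x)) → Subset n
  comprehension {n} P? = fromList (filter P? (allFin n))

  ∈-comprehension⁺ : ∀ {n} {P : Fin n → Set} (P? : ∀ x → Dec (P x)) {x} → P x → x ∈ˢ comprehension P?
  ∈-comprehension⁺ P? p = ∈-fromList (∈-filter⁺ P? (∈-allFin _) p)

  ∈-comprehension⁻ : ∀ {n} {P : Fin n → Set} (P? : ∀ x → Dec (P x)) {x} → x ∈ˢ comprehension P? → P x
  ∈-comprehension⁻ {n} P? x∈ =
    proj₂ (∈-filter⁻ P? {xs = allFin n} (∈-fromList⁻ (filter P? (allFin n)) x∈))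

∣comprehension∣ : ∀ {n} {P : Fin n → Set} (P? : ∀ x → Dec (P x)) → ∣ comprehension P? ∣ ≤ count P?
∣comprehension∣ P? = ≤-trans (≤-reflexive (∣p∣≡count (comprehension P?)))
  (count-mono (_∈? comprehension P?) P? (∈-comprehension⁻ P?))

all-or : ∀ {ℓ : Level} {n} {A : Set} {P : Fin n → Set ℓ} → (∀ i → A ⊎ P i) → A ⊎ (∀ i → P i)
all-or {n = zero} f = inj₂ λ ()
all-or {n = suc n} f with f zero | all-or (f ∘ suc)
... | inj₁ a | _ = inj₁ a
... | _ | inj₁ a = inj₁ a
... | inj₂ p | inj₂ ps = inj₂ λ { zero → p ; (suc i) → ps i }

opaque
  others : ∀ {k} → Fin (suc k) → List (Fin (suc k))
  others {k} i = filter (λ j → ¬? (j Fin.≟ i)) (allFin (suc k))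

  ∈-others⁺ : ∀ {k} {i j : Fin (suc k)} → j ≢ i → j ∈ others i
  ∈-others⁺ {i = i} = ∈-filter⁺ (λ j → ¬? (j Fin.≟ i)) (∈-allFin _)

  ∈-others⁻ : ∀ {k} {i j : Fin (suc k)} → j ∈ others i → j ≢ i
  ∈-others⁻ {k} {i} j∈ = proj₂ (∈-filter⁻ (λ j → ¬? (j Fin.≟ i)) {xs = allFin (suc k)} j∈)

  others-unique : ∀ {k} (i : Fin (suc k)) → Unique (others i)
  others-unique {k} i = Unique.filter⁺ (λ j → ¬? (j Fin.≟ i)) (Unique.allFin⁺ (suc k))

length-others : ∀ {k} (i : Fin (suc k)) → length (others i) ≡ k
length-others {k} i = suc-injective (trans
  (≤-antisym (unique-⊆-length (All.tabulate (λ j∈ → ∈-others⁻ j∈ ∘ sym) ∷ others-unique i) (λ {j} _ → ∈-allFin j))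
    (unique-⊆-length (Unique.allFin⁺ (suc k)) λ {j} _ → split j))
  (length-allFin (suc k)))
  where
  split : ∀ j → j ∈ i ∷ others i
  split j with j Fin.≟ i
  ... | yes j≡i = here j≡i
  ... | no j≢i = there (∈-others⁺ j≢i)

another : ∀ {k} (i : Fin (suc k)) → 1 ≤ k → ∃[ j ] j ≢ i
another {suc k} zero _ = suc zero , λ ()
another {suc k} (suc i) _ = zero , λ ()

module Main (m k t B D : ℕ) (χ : Colouring (suc m) (suc k)) (1≤k : 1 ≤ k) (2≤m : 2 ≤ m) (t-large : 4 + k ≤ t)
  (n-large : suc k + suc k * t < suc m)
  (B-large : k + 2 * t + 2 * suc k * t ≤ B) (D-large : k + suc k * B + 2 * t ≤ D)
  (D-large′ : k * (2 * suc k * t) + suc (suc k * t + k * (2 * suc k * t)) ≤ D)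
  (n-large′ : suc ((k * (2 * suc k * t) + suc k * D) + (k * (2 * suc k * t) + suc k * D)) < suc m)
  (n-large″ : (2 * t + (2 * suc k * t + suc k)) * D < suc m) where

  c = suc k
  -- `R` is the length of the longer list in `two-freedoms`, hence a number of stars that no two
  -- colours can both reach. `K` allows `Q` up to `R` stars from each of `k` colours.
  R = 2 * c * t
  K = k * R

  t≤D : t ≤ D
  t≤D = ≤-trans (≤-trans (m≤m+n t (t + 0)) (m≤n+m (2 * t) (k + suc k * B))) D-large

  open Stars m c t D χ 2≤m t-large t≤D n-large

  Ham : Set
  Ham = MonoHamBergeCycle m (suc c) c χ

  1≤t : 1 ≤ t
  1≤t = ≤-trans (s≤s z≤n) t-large

  1≤R : 1 ≤ R
  1≤R = *-mono-≤ {1} {2 * c} (s≤s z≤n) 1≤t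

  k≤K : k ≤ K
  k≤K = ≤-trans (≤-reflexive (sym (*-identityʳ k))) (*-monoʳ-≤ k 1≤R)

  c*D<n : c * D < n
  c*D<n = ≤-trans (s≤s (*-monoˡ-≤ D (≤-trans (m≤n+m c (2 * c * t)) (m≤n+m _ (2 * t))))) n-large″

  module EvadeAt (i : Fin c) (Q : Subset n) (∣Q∣≤K : ∣ Q ∣ ≤ K) = Evasion K D-large′ n-large′ i Q ∣Q∣≤K

  stars-but-one′ : Ham ⊎ ∃[ a ] (∀ j → j ≢ a → ∃[ x ] Star j x)
  stars-but-one′ with all-or (λ i → Private.hamiltonian-or-stable m c t χ 2≤m t-large i ∅)
  ... | inj₁ ham = inj₁ ham
  ... | inj₂ H = inj₂ (Chains.stars-but-one m k t D B χ 2≤m t-large t≤D n-large B-large D-large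
      (λ i → proj₁ (H i)) (λ i a → light (proj₁ (proj₂ (H i)) a))
      (λ i → proj₁ (proj₂ (proj₂ (H i)))) (λ i → proj₂ (proj₂ (proj₂ (H i)))))
    where
    light : ∀ {i u v} → Private.Unusable m c t χ 2≤m t-large i ∅ u v → Light i u v
    light (_ , inj₁ (u∈ , _)) = ⊥-elim (∉⊥ u∈)
    light (_ , inj₂ (l , _)) = l

  -- `Q` is one star of each other colour and is itself the profile through each of its vertices.
  -- Stars of different colours are not yet known to be distinct, so the set is padded to `k`
  -- vertices.
  star-for : ∀ a → (∀ j → j ≢ a → ∃[ x ] Star j x) → Ham ⊎ ∃[ x ] Star a x
  star-for a stars = conclude (find-evader (x j₀ , x∈W j₀ j₀≢a) λ q q∈ →
      W , q∈ , cong suc ∣W∣ , id , x , x∈W , x-star)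
    where
    x : Fin c → V
    x j with j Fin.≟ a
    ... | yes _ = zero
    ... | no j≢a = proj₁ (stars j j≢a)
    x-star : ∀ j → j ≢ a → Star j (x j)
    x-star j j≢a with j Fin.≟ a
    ... | yes j≡a = ⊥-elim (j≢a j≡a)
    ... | no j≢a = proj₂ (stars j j≢a)
    opaque
      padded : ∃[ W ] fromList (map x (others a)) ⊆ˢ W × ∣ W ∣ ≡ k
      padded = pad k (fromList (map x (others a))) (≤-trans (∣fromList∣≤ (map x (others a)))
        (≤-reflexive (trans (length-map x (others a)) (length-others a))))
        (≤-trans (≤-trans (n≤1+n k) (m≤m+n c _)) (<⇒≤ n-large))
    W = proj₁ padded
    ∣W∣ = proj₂ (proj₂ padded)
    x∈W : ∀ j → j ≢ a → x j ∈ˢ W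
    x∈W j j≢a = proj₁ (proj₂ padded) (∈-fromList (∈-map⁺ x (∈-others⁺ j≢a)))
    j₀ = proj₁ (another a 1≤k)
    j₀≢a = proj₂ (another a 1≤k)
    open EvadeAt a W (≤-trans (≤-reflexive ∣W∣) k≤K)
    conclude : Ham ⊎ ∃[ e ] Evades e → Ham ⊎ ∃[ e ] Star a e
    conclude (inj₁ ham) = inj₁ ham
    conclude (inj₂ (e , ev)) = inj₂ (e , evades-star ev)

  common-neighbour : ∀ (ps : List (Fin c × V)) → (∀ {j x} → (j , x) ∈ ps → Star j x) → length ps * D < n →
    ∃[ z ] (∀ {j x} → (j , x) ∈ ps → Light j x z)
  common-neighbour ps star lt =
    let z , ¬m = count-exists missing? (≤-trans (s≤s (count-⋃ missing?
          (λ (j , x) y → ¬? (light? j x y)) ps D (λ { {j , x} p∈ → star p∈ }) find)) lt)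
    in z , λ {j} {x} p∈ → decidable-stable (light? j x z) λ ¬l → ¬m (lose p∈ ¬l)
    where
    missing? : ∀ z → Dec (Any (λ p → ¬ Light (proj₁ p) (proj₂ p) z) ps)
    missing? z = any? (λ (j , x) → ¬? (light? j x z)) ps

  module AllStars (stars : ∀ j → ∃[ x ] Star j x) where

    s : Fin c → V
    s j = proj₁ (stars j)

    -- If `x` serves two colours, stars for all `c` colours fit into `k` vertices, and together with
    -- a common light partner z they make a set of at most `c` vertices covering every colour.
    stars-disjoint : ∀ {i j x} → Star i x → Star j x → i ≡ j
    stars-disjoint {i} {j} {x} xi xj with i Fin.≟ j
    ... | yes i≡j = i≡j
    ... | no i≢j = ⊥-elim (not-all-covered n-large {W ⊕ z}
        (≤-trans (∣p⊕x∣≤ W z) (s≤s (≤-trans (∣fromList∣≤ (map y (others i)))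
          (≤-reflexive (trans (length-map y (others i)) (length-others i)))))) covered)
      where
      y : Fin c → V
      y l with l Fin.≟ i | l Fin.≟ j
      ... | no _ | no _ = s l
      ... | _ | _ = x
      y-star : ∀ l → Star l (y l)
      y-star l with l Fin.≟ i | l Fin.≟ j
      ... | no _ | no _ = proj₂ (stars l)
      ... | yes refl | _ = xi
      ... | no _ | yes refl = xj
      yi≡yj : y i ≡ y j
      yi≡yj with i Fin.≟ i | i Fin.≟ j | j Fin.≟ i | j Fin.≟ j
      ... | no ¬p | _ | _ | _ = ⊥-elim (¬p refl)
      ... | _ | _ | _ | no ¬p = ⊥-elim (¬p refl)
      ... | yes _ | _ | no _ | yes _ = refl
      ... | yes _ | _ | yes _ | yes _ = refl
      W = fromList (map y (others i))
      generic : ∃[ z ] (∀ {l v} → (l , v) ∈ map (λ l → l , y l) (allFin c) → Light l v z)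
      generic = common-neighbour (map (λ l → l , y l) (allFin c))
        (λ p∈ → let l , _ , eq = ∈-map⁻ (λ l → l , y l) p∈ in subst (λ (l , v) → Star l v) (sym eq) (y-star l))
        (subst (λ N → N * D < n) (sym (trans (length-map (λ l → l , y l) (allFin c)) (length-allFin c))) c*D<n)
      z = proj₁ generic
      y∈W : ∀ l → Dec (l ≡ i) → y l ∈ˢ W
      y∈W l (no l≢i) = ∈-fromList (∈-map⁺ y (∈-others⁺ l≢i))
      y∈W l (yes refl) = subst (_∈ˢ W) (sym yi≡yj) (∈-fromList (∈-map⁺ y (∈-others⁺ (i≢j ∘ sym))))
      covered : ∀ l → Covers l (W ⊕ z)
      covered l = y l , z , p⊆p⊕x W z (y∈W l (l Fin.≟ i)) , x∈p⊕x W z ,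
        proj₂ generic (∈-map⁺ (λ l → l , y l) (∈-allFin l))

    -- Stars of `i` and `j` form the two lists of `two-freedoms`. `W` consists of one star of each
    -- remaining colour and a vertex z light with all the stars involved, so that x completes colour
    -- `i` and y completes colour `j`.
    not-two-large : ∀ {i j} → i ≢ j → R ≤ count (star? i) → R ≤ count (star? j) → ⊥
    not-two-large {i} {j} i≢j Ri Rj =
      two-freedoms {W} {j} {X} {Y} ∣W∣ (proj₁ (proj₂ (proj₂ X-family))) (proj₁ (proj₂ (proj₂ Y-family)))
        (λ x∈ → ∉W i (inj₁ refl) (X-star x∈) (light-X x∈)) (λ y∈ → ∉W j (inj₂ refl) (Y-star y∈) (light-Y y∈))
        (λ { x∈ y∈ refl → i≢j (stars-disjoint (X-star x∈) (Y-star y∈)) }) covX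
        (λ {y} y∈ → y , z , x∈p⊕x W y , p⊆p⊕x W y z∈W , light-Y y∈) ∣X∣ (proj₁ (proj₂ Y-family)) z<s 1≤t
      where
      opaque
        X-family : ∃[ zs ] length zs ≡ 2 * t × Unique zs × (∀ {z} → z ∈ zs → z ∈ allFin n × Star i z)
        X-family = subfamily (star? i) (2 * t) (Unique.allFin⁺ n)
          (≤-trans (*-monoˡ-≤ t (≤-trans (≤-reflexive (sym (*-identityʳ 2))) (*-monoʳ-≤ 2 {1} {c} (s≤s z≤n)))) Ri)
        Y-family : ∃[ zs ] length zs ≡ 2 * c * t × Unique zs × (∀ {z} → z ∈ zs → z ∈ allFin n × Star j z)
        Y-family = subfamily (star? j) (2 * c * t) (Unique.allFin⁺ n) Rj
      X = proj₁ X-family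
      Y = proj₁ Y-family
      ∣X∣ = proj₁ (proj₂ X-family)
      X-star : ∀ {x} → x ∈ X → Star i x
      X-star x∈ = proj₂ (proj₂ (proj₂ (proj₂ X-family)) x∈)
      Y-star : ∀ {y} → y ∈ Y → Star j y
      Y-star y∈ = proj₂ (proj₂ (proj₂ (proj₂ Y-family)) y∈)
      tagged : List (Fin c × V)
      tagged = map (i ,_) X ++ map (j ,_) Y ++ map (λ l → l , s l) (allFin c)
      tagged-star : ∀ {l v} → (l , v) ∈ tagged → Star l v
      tagged-star p∈ with ∈-++⁻ (map (i ,_) X) p∈
      ... | inj₁ q with _ , x∈ , refl ← ∈-map⁻ (i ,_) q = X-star x∈
      ... | inj₂ q with ∈-++⁻ (map (j ,_) Y) q
      ...   | inj₁ r with _ , y∈ , refl ← ∈-map⁻ (j ,_) r = Y-star y∈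
      ...   | inj₂ r with l , _ , refl ← ∈-map⁻ (λ l → l , s l) r = proj₂ (stars l)
      opaque
        generic : ∃[ z ] (∀ {l v} → (l , v) ∈ tagged → Light l v z)
        generic = common-neighbour tagged tagged-star (subst (λ N → N * D < n) (sym length-tagged) n-large″)
          where
          length-tagged : length tagged ≡ 2 * t + (2 * c * t + c)
          length-tagged = trans (length-++ (map (i ,_) X)) (cong₂ _+_ (trans (length-map (i ,_) X) ∣X∣)
            (trans (length-++ (map (j ,_) Y)) (cong₂ _+_ (trans (length-map (j ,_) Y) (proj₁ (proj₂ Y-family)))
              (trans (length-map (λ l → l , s l) (allFin c)) (length-allFin c)))))
      z = proj₁ generic
      light-X : ∀ {x} → x ∈ X → Light i x z
      light-X x∈ = proj₂ generic (∈-++⁺ˡ (∈-map⁺ (i ,_) x∈))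
      light-Y : ∀ {y} → y ∈ Y → Light j y z
      light-Y y∈ = proj₂ generic (∈-++⁺ʳ (map (i ,_) X) (∈-++⁺ˡ (∈-map⁺ (j ,_) y∈)))
      light-s : ∀ l → Light l (s l) z
      light-s l = proj₂ generic (∈-++⁺ʳ (map (i ,_) X) (∈-++⁺ʳ (map (j ,_) Y) (∈-map⁺ (λ l → l , s l) (∈-allFin l))))
      rest : List (Fin c)
      rest = filter (λ l → ¬? (l Fin.≟ j)) (others i)
      ∈-rest⁻ : ∀ {l} → l ∈ rest → l ≢ i × l ≢ j
      ∈-rest⁻ l∈ = let l∈′ , l≢j = ∈-filter⁻ (λ l → ¬? (l Fin.≟ j)) {xs = others i} l∈ in ∈-others⁻ l∈′ , l≢j
      ∈-rest⁺ : ∀ {l} → l ≢ i → l ≢ j → l ∈ rest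
      ∈-rest⁺ l≢i l≢j = ∈-filter⁺ (λ l → ¬? (l Fin.≟ j)) (∈-others⁺ l≢i) l≢j
      rest-unique : Unique rest
      rest-unique = Unique.filter⁺ (λ l → ¬? (l Fin.≟ j)) (others-unique i)
      ∣rest∣ : suc (length rest) ≡ k
      ∣rest∣ = trans (≤-antisym
          (unique-⊆-length (All.tabulate (λ l∈ → proj₂ (∈-rest⁻ l∈) ∘ sym) ∷ rest-unique) to)
          (unique-⊆-length (others-unique i) from)) (length-others i)
        where
        to : ∀ {l} → l ∈ j ∷ rest → l ∈ others i
        to (here refl) = ∈-others⁺ (i≢j ∘ sym)
        to (there l∈) = ∈-others⁺ (proj₁ (∈-rest⁻ l∈))
        from : ∀ {l} → l ∈ others i → l ∈ j ∷ rest
        from {l} l∈ with l Fin.≟ j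
        ... | yes l≡j = here l≡j
        ... | no l≢j = there (∈-rest⁺ (∈-others⁻ l∈) l≢j)
      core : List V
      core = z ∷ map s rest
      core-unique : Unique core
      core-unique = All.tabulate z≢ ∷ unique-map s
        (λ {l} {l′} _ _ eq → stars-disjoint (proj₂ (stars l)) (subst (Star l′) (sym eq) (proj₂ (stars l′)))) rest-unique
        where
        z≢ : ∀ {v} → v ∈ map s rest → z ≢ v
        z≢ v∈ z≡v = let l , _ , v≡ = ∈-map⁻ s v∈ in proj₁ (light-s l) (sym (trans z≡v v≡))
      W = fromList core
      ∣W∣ : suc ∣ W ∣ ≡ c
      ∣W∣ = cong suc (trans (∣fromList∣ core-unique) (trans (cong suc (length-map s rest)) ∣rest∣))
      z∈W : z ∈ˢ W
      z∈W = ∈-fromList (here refl)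
      ∉W : ∀ l {v} → l ≡ i ⊎ l ≡ j → Star l v → Light l v z → v ∉ˢ W
      ∉W l l∈ star light v∈ with ∈-fromList⁻ core v∈
      ... | here v≡z = proj₁ light v≡z
      ... | there v∈′ with l′ , l′∈ , refl ← ∈-map⁻ s v∈′
                      with stars-disjoint star (proj₂ (stars l′)) | l∈
      ...   | refl | inj₁ p = proj₁ (∈-rest⁻ l′∈) p
      ...   | refl | inj₂ p = proj₂ (∈-rest⁻ l′∈) p
      covX : ∀ {x} → x ∈ X → ∀ l → l ≢ j → Covers l (W ⊕ x)
      covX {x} x∈ l l≢j with l Fin.≟ i
      ... | yes refl = x , z , x∈p⊕x W x , p⊆p⊕x W x z∈W , light-X x∈
      ... | no l≢i = s l , z , p⊆p⊕x W x (∈-fromList (there (∈-map⁺ s (∈-rest⁺ l≢i l≢j)))) ,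
        p⊆p⊕x W x z∈W , light-s l

    -- `T` is a selection of stars, since one colour may have too many for a small `Q`. By
    -- `stars-disjoint`, choosing one for each colour but `i` gives exactly `k` vertices, with any
    -- vertex of `Q` among them.
    module Restricted (T : Fin c → V → Set) (T? : ∀ j x → Dec (T j x)) (T-star : ∀ {j x} → T j x → Star j x)
      (i : Fin c) (bounded : ∀ j → j ≢ i → count (T? j) ≤ R) (inhabited : ∀ j → j ≢ i → ∃[ x ] T j x) where

      Other : V → Set
      Other x = ∃[ j ] j ≢ i × T j x

      opaque
        other? : ∀ x → Dec (Other x)
        other? x = Fin.any? λ j → ¬? (j Fin.≟ i) ×-dec T? j x

      Q : Subset n
      Q = comprehension other?

      ∣Q∣≤K : ∣ Q ∣ ≤ K
      ∣Q∣≤K = ≤-trans (∣comprehension∣ other?) (subst (λ N → count other? ≤ N * R) (length-others i)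
        (count-⋃ other? T? (others i) R (λ j∈ → bounded _ (∈-others⁻ j∈))
          λ { (j , j≢i , Tx) → j , ∈-others⁺ j≢i , Tx }))

      open EvadeAt i Q ∣Q∣≤K public

      profile-through : ∀ q → q ∈ˢ Q → ∃[ W ] q ∈ˢ W × Profile W
      profile-through q q∈ with j₀ , j₀≢i , Tq ← ∈-comprehension⁻ other? q∈ =
        W , q∈W , cong suc ∣W∣ , W⊆Q , x ,
        (λ j j≢i → ∈-fromList (∈-map⁺ x (∈-others⁺ j≢i))) , (λ j j≢i → T-star (x-T j j≢i))
        where
        x : Fin c → V
        x j with j Fin.≟ i | j Fin.≟ j₀
        ... | no _ | yes _ = q
        ... | no j≢i | no _ = proj₁ (inhabited j j≢i)
        ... | yes _ | _ = q
        x-T : ∀ j → j ≢ i → T j (x j)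
        x-T j j≢i with j Fin.≟ i | j Fin.≟ j₀
        ... | no _ | yes refl = Tq
        ... | no j≢i | no _ = proj₂ (inhabited j j≢i)
        ... | yes j≡i | _ = ⊥-elim (j≢i j≡i)
        x-j₀ : x j₀ ≡ q
        x-j₀ with j₀ Fin.≟ i | j₀ Fin.≟ j₀
        ... | no _ | yes _ = refl
        ... | yes _ | _ = refl
        ... | no _ | no ¬p = ⊥-elim (¬p refl)
        W = fromList (map x (others i))
        q∈W : q ∈ˢ W
        q∈W = subst (_∈ˢ W) x-j₀ (∈-fromList (∈-map⁺ x (∈-others⁺ j₀≢i)))
        ∣W∣ : ∣ W ∣ ≡ k
        ∣W∣ = trans (∣fromList∣ (unique-map x (λ {j} {j′} j∈ j′∈ eq → stars-disjoint (T-star (x-T j (∈-others⁻ j∈)))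
            (subst (Star j′) (sym eq) (T-star (x-T j′ (∈-others⁻ j′∈))))) (others-unique i)))
          (trans (length-map x (others i)) (length-others i))
        W⊆Q : W ⊆ˢ Q
        W⊆Q v∈ with j , j∈ , refl ← ∈-map⁻ x (∈-fromList⁻ (map x (others i)) v∈) =
          ∈-comprehension⁺ other? (j , ∈-others⁻ j∈ , x-T j (∈-others⁻ j∈))

      evader : (∃[ j ] j ≢ i) → Ham ⊎ ∃[ e ] Evades e
      evader (j , j≢i) = find-evader
        (proj₁ (inhabited j j≢i) , ∈-comprehension⁺ other? (j , j≢i , proj₂ (inhabited j j≢i))) profile-through

    module Final (a : Fin c) (small : ∀ j → j ≢ a → count (star? j) ≤ R) where

      module First = Restricted Star star? id a small (λ j _ → stars j)

      module Then (e : V) (e-evades : First.Evades e) where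

        -- In colour `a`, which may have too many stars, only the evader `e` is kept.
        T : Fin c → V → Set
        T j x = Star j x × (j ≡ a → x ≡ e)

        opaque
          T? : ∀ j x → Dec (T j x)
          T? j x = star? j x ×-dec ((j Fin.≟ a) →-dec (x Fin.≟ e))

        T-e : T a e
        T-e = First.evades-star e-evades , λ _ → refl

        T-count′ : ∀ j → Dec (j ≡ a) → count (T? j) ≤ R
        T-count′ j (yes j≡a) = ≤-trans (count-mono (T? j) (Fin._≟ e) λ (_ , eq) → eq j≡a) (≤-trans (count-≡ e) 1≤R)
        T-count′ j (no j≢a) = ≤-trans (count-mono (T? j) (star? j) proj₁) (small j j≢a)

        T-count : ∀ j → count (T? j) ≤ R
        T-count j = T-count′ j (j Fin.≟ a)

        T-inhabited : ∀ j → ∃[ x ] T j x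
        T-inhabited j with j Fin.≟ a
        ... | yes refl = e , T-e
        ... | no j≢a = s j , proj₂ (stars j) , λ j≡a → ⊥-elim (j≢a j≡a)

        -- `T-vertex` and `contains` together put the vertex of each colour into the `Q` of every
        -- other colour.
        record Evader (i : Fin c) : Set where
          field
            Q      : Subset n
            ∣Q∣≤K  : ∣ Q ∣ ≤ K
            vertex : V
            evades : EvadeAt.Evades i Q ∣Q∣≤K vertex
            T-vertex : T i vertex
            contains : ∀ {j x} → j ≢ i → T j x → x ∈ˢ Q

        evader-elsewhere : ∀ i → i ≢ a → Ham ⊎ Evader i
        evader-elsewhere i i≢a = Sum.map₂ pack (At.evader (another i 1≤k))
          where
          module At = Restricted T T? proj₁ i (λ j _ → T-count j) (λ j _ → T-inhabited j)
          pack : ∃[ v ] At.Evades v → Evader i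
          pack (v , v-evades) = record
            { Q = At.Q ; ∣Q∣≤K = At.∣Q∣≤K ; vertex = v ; evades = v-evades
            ; T-vertex = At.evades-star v-evades , λ i≡a → ⊥-elim (i≢a i≡a)
            ; contains = λ j≢i Tx → ∈-comprehension⁺ At.other? (_ , j≢i , Tx) }

        evader-here : Evader a
        evader-here = record
          { Q = First.Q ; ∣Q∣≤K = First.∣Q∣≤K ; vertex = e ; evades = e-evades ; T-vertex = T-e
          ; contains = λ j≢i Tx → ∈-comprehension⁺ First.other? (_ , j≢i , proj₁ Tx) }

        evader-at : ∀ i → Dec (i ≡ a) → Ham ⊎ Evader i
        evader-at i (yes i≡a) = inj₂ (subst Evader (sym i≡a) evader-here)
        evader-at i (no i≢a) = evader-elsewhere i i≢a

        -- The edge formed by all the evading vertices and a generic z is private for its own colour.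
        no-evaders : ¬ (∀ i → Evader i)
        no-evaders evaders = ¬spoilt i (inj₂ (inj₂ (S , v∉Q i , z∉Q , (∣S∣ , v∈S i , x∈p⊕x X z , refl) , only)))
          where
          module E i = Evader (evaders i)
          module At i = EvadeAt i (E.Q i) (E.∣Q∣≤K i)
          v : Fin c → V
          v = E.vertex
          v∉Q : ∀ i → v i ∉ˢ E.Q i
          v∉Q i = proj₁ (E.evades i)
          opaque
            generic : ∃[ z ] (∀ i → ¬ At.Spoilt i (v i) z)
            generic =
              let z , ¬s = count-exists spoilt? (≤-trans (s≤s (subst (λ N → count spoilt? ≤ N * D) (length-allFin c)
                    (count-⋃ spoilt? (λ i → At.spoilt? i (v i)) (allFin c) D (λ {i} _ → proj₂ (E.evades i))
                      λ { (i , p) → i , ∈-allFin i , p }))) c*D<n)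
              in z , λ i p → ¬s (i , p)
              where
              spoilt? : ∀ z → Dec (∃[ i ] At.Spoilt i (v i) z)
              spoilt? z = Fin.any? λ i → At.spoilt? i (v i) z
          z = proj₁ generic
          ¬spoilt : ∀ i → ¬ At.Spoilt i (v i) z
          ¬spoilt = proj₂ generic
          v≢z : ∀ i → v i ≢ z
          v≢z i = proj₁ (decidable-stable (light? i (v i) z) (¬spoilt i ∘ inj₂ ∘ inj₁))
          v-injective : ∀ {i j} → v i ≡ v j → i ≡ j
          v-injective {i} {j} eq = decidable-stable (i Fin.≟ j) λ i≢j →
            v∉Q i (subst (_∈ˢ E.Q i) (sym eq) (E.contains i (i≢j ∘ sym) (E.T-vertex j)))
          X = fromList (map v (allFin c))
          S = X ⊕ z
          i = χ S
          z∉Q : z ∉ˢ E.Q i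
          z∉Q = ¬spoilt i ∘ inj₁
          z∉X : z ∉ˢ X
          z∉X z∈ = let j , _ , eq = ∈-map⁻ v (∈-fromList⁻ (map v (allFin c)) z∈) in v≢z j (sym eq)
          ∣S∣ : ∣ S ∣ ≡ suc c
          ∣S∣ = trans (∣p⊕x∣ X z z∉X) (cong suc (trans
            (∣fromList∣ (Unique.map⁺ v-injective (Unique.allFin⁺ c)))
            (trans (length-map v (allFin c)) (length-allFin c))))
          v∈S : ∀ j → v j ∈ˢ S
          v∈S j = p⊆p⊕x X z (∈-fromList (∈-map⁺ v (∈-allFin j)))
          only : ∀ w → w ∈ˢ S → w ∈ˢ E.Q i ⊎ (w ≡ v i ⊎ w ≡ z)
          only w w∈ with ∈-⊕⁻ X z w∈
          ... | inj₂ w≡z = inj₂ (inj₂ w≡z)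
          ... | inj₁ w∈X with j , _ , refl ← ∈-map⁻ v (∈-fromList⁻ (map v (allFin c)) w∈X) with j Fin.≟ i
          ...   | yes j≡i = inj₂ (inj₁ (cong v j≡i))
          ...   | no j≢i = inj₁ (E.contains i j≢i (E.T-vertex j))

        conclusion : Ham
        conclusion = Sum.[ id , ⊥-elim ∘ no-evaders ]′ (all-or λ i → evader-at i (i Fin.≟ a))

      conclusion : Ham
      conclusion = Sum.[ id , (λ (e , e-evades) → Then.conclusion e e-evades) ]′ (First.evader (another a 1≤k))

    conclusion : Ham
    conclusion with Fin.any? (λ a → R ≤? count (star? a))
    ... | yes (a , large) = Final.conclusion a λ j j≢a → <⇒≤ (≰⇒> λ Rj → not-two-large j≢a Rj large)
    -- No colour has `R` stars, so any colour can take the part of `a`.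
    ... | no none = Final.conclusion zero λ j _ → <⇒≤ (≰⇒> λ Rj → none (j , Rj))

  hamiltonian : Ham
  hamiltonian with stars-but-one′
  ... | inj₁ ham = ham
  ... | inj₂ (a , stars) with star-for a stars
  ...   | inj₁ ham = ham
  ...   | inj₂ star = AllStars.conclusion all
    where
    all : ∀ j → ∃[ x ] Star j x
    all j with j Fin.≟ a
    ... | yes refl = star
    ... | no j≢a = stars j j≢a

-- The bound on n

C-monoˡ : ∀ n k → n C k ≤ suc n C k
C-monoˡ n zero = ≤-refl
C-monoˡ n (suc k) = ≤-trans (m≤n+m (n C suc k) (n C k)) (≤-reflexive (nCk+nC[k+1]≡[n+1]C[k+1] n k))

-- Four Pascal steps split the right side into C(n+3, k), C(n+2, k), C(n+1, k), C(n, k) and a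
-- remainder; each of the four is at least C(n, k).
C-quadruple : ∀ n k → 4 * (n C k) ≤ (4 + n) C suc k
C-quadruple n k = begin
  x + (x + (x + (x + 0))) ≤⟨ +-mono-≤ mono₃ (+-mono-≤ mono₂ (+-mono-≤ (C-monoˡ n k) (+-monoʳ-≤ x z≤n))) ⟩
  (3 + n) C k + ((2 + n) C k + ((1 + n) C k + (x + n C suc k)))
    ≡⟨ cong (λ y → (3 + n) C k + ((2 + n) C k + ((1 + n) C k + y))) (pascal n) ⟩
  (3 + n) C k + ((2 + n) C k + ((1 + n) C k + (1 + n) C suc k))
    ≡⟨ cong (λ y → (3 + n) C k + ((2 + n) C k + y)) (pascal (1 + n)) ⟩
  (3 + n) C k + ((2 + n) C k + (2 + n) C suc k) ≡⟨ cong ((3 + n) C k +_) (pascal (2 + n)) ⟩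
  (3 + n) C k + (3 + n) C suc k ≡⟨ pascal (3 + n) ⟩
  (4 + n) C suc k ∎
  where
  open ≤-Reasoning
  x = n C k
  pascal : ∀ n → n C k + n C suc k ≡ suc n C suc k
  pascal n = nCk+nC[k+1]≡[n+1]C[k+1] n k
  mono₂ : x ≤ (2 + n) C k
  mono₂ = ≤-trans (C-monoˡ n k) (C-monoˡ (1 + n) k)
  mono₃ : x ≤ (3 + n) C k
  mono₃ = ≤-trans mono₂ (C-monoˡ (2 + n) k)

-- The squares grow by a factor of at most 2, and so does the quotient (9 + q) / (7 + q) left after
-- cancelling 8 + q.
growth : ∀ q → 2 * (5 + q) * (5 + q) * (8 + q) * (9 + q) ≤ 4 * (2 * (4 + q) * (4 + q) * (7 + q) * (8 + q))
growth q = begin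
  2 * (5 + q) * (5 + q) * (8 + q) * (9 + q) ≡⟨ regroup (5 + q) (8 + q) (9 + q) ⟩
  2 * ((5 + q) * (5 + q)) * (9 + q) * (8 + q)
    ≤⟨ *-monoˡ-≤ (8 + q) (*-mono-≤ (*-monoʳ-≤ 2 squares) linear) ⟩
  2 * (2 * ((4 + q) * (4 + q))) * (2 * (7 + q)) * (8 + q) ≡⟨ expand (4 + q) (7 + q) (8 + q) ⟩
  4 * (2 * (4 + q) * (4 + q) * (7 + q) * (8 + q)) ∎
  where
  open ≤-Reasoning
  regroup : ∀ a u w → 2 * a * a * u * w ≡ 2 * (a * a) * w * u
  regroup = solve-∀
  expand : ∀ c t u → 2 * (2 * (c * c)) * (2 * t) * u ≡ 4 * (2 * c * c * t * u)
  expand = solve-∀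
  square-slack : ∀ q → (5 + q) * (5 + q) + (7 + q * (6 + q)) ≡ 2 * ((4 + q) * (4 + q))
  square-slack = solve-∀
  linear-slack : ∀ q → 9 + q + (5 + q) ≡ 2 * (7 + q)
  linear-slack = solve-∀
  squares : (5 + q) * (5 + q) ≤ 2 * ((4 + q) * (4 + q))
  squares = ≤-trans (m≤m+n _ (7 + q * (6 + q))) (≤-reflexive (square-slack q))
  linear : 9 + q ≤ 2 * (7 + q)
  linear = ≤-trans (m≤m+n _ (5 + q)) (≤-reflexive (linear-slack q))

-- With r = 5 + q, c = r - 1 and t = r + 2 the left side is 2c²t(t+1). Raising r by one multiplies
-- it by at most 4 and the binomial by at least 4. The start r = 5 reads 1792 ≤ 4845; for r = 4 it
-- would read 756 ≤ 560.
C-lower : ∀ q → 2 * (4 + q) * (4 + q) * (7 + q) * (8 + q) ≤ (4 * (5 + q)) C (4 + q)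
C-lower zero = ≤ᵇ⇒≤ 1792 (20 C 4) _
C-lower (suc q) = begin
  2 * (5 + q) * (5 + q) * (8 + q) * (9 + q) ≤⟨ growth q ⟩
  4 * (2 * (4 + q) * (4 + q) * (7 + q) * (8 + q)) ≤⟨ *-monoʳ-≤ 4 (C-lower q) ⟩
  4 * ((4 * (5 + q)) C (4 + q)) ≤⟨ C-quadruple (4 * (5 + q)) (4 + q) ⟩
  (4 + 4 * (5 + q)) C (5 + q) ≡⟨ cong (_C (5 + q)) (sym (*-suc 4 (5 + q))) ⟩
  (4 * (6 + q)) C (5 + q) ∎
  where open ≤-Reasoning

module Bounds (k t : ℕ) (k≤t : k ≤ t) (3≤k : 3 ≤ k) where

  open ≤-Reasoning

  c = suc k
  R = 2 * c * t
  B = k + 2 * t + R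
  -- In `D-large` the term c R takes 2c²t and the rest at most 3c²t; `D-large′` asks for 4kct + ct +
  -- 1, which also fits.
  D = 5 * c * c * t
  -- The common light partner in `not-two-large` must suit 2t + R + c stars, each missing up to `D`
  -- vertices.
  N = (2 * t + (R + c)) * D

  1≤ct : 1 ≤ c * t
  1≤ct = *-mono-≤ {1} {c} (s≤s z≤n) (≤-trans (s≤s z≤n) (≤-trans 3≤k k≤t))

  D-large : k + c * B + 2 * t ≤ D
  D-large = begin
    k + c * B + 2 * t
      ≤⟨ +-monoˡ-≤ (2 * t) (+-mono-≤ k≤t (*-monoʳ-≤ c (+-monoˡ-≤ R (+-monoˡ-≤ (2 * t) k≤t)))) ⟩
    t + c * (t + 2 * t + 2 * c * t) + 2 * t ≡⟨ collect c t ⟩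
    (3 * (1 + c) + 2 * (c * c)) * t ≤⟨ *-monoˡ-≤ t (+-monoˡ-≤ (2 * (c * c)) (*-monoʳ-≤ 3 1+c≤c²)) ⟩
    (3 * (c * c) + 2 * (c * c)) * t ≡⟨ merge c t ⟩
    D ∎
    where
    collect : ∀ c t → t + c * (t + 2 * t + 2 * c * t) + 2 * t ≡ (3 * (1 + c) + 2 * (c * c)) * t
    collect = solve-∀
    merge : ∀ c t → (3 * (c * c) + 2 * (c * c)) * t ≡ 5 * c * c * t
    merge = solve-∀
    1+c≤c² : 1 + c ≤ c * c
    1+c≤c² = ≤-trans (+-monoˡ-≤ c (s≤s (z≤n {k}))) (+-monoʳ-≤ c (≤-trans (≤-reflexive (sym (*-identityˡ c)))
      (*-monoˡ-≤ c (≤-trans (s≤s z≤n) 3≤k))))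

  D-large′ : k * R + suc (c * t + k * R) ≤ D
  D-large′ = begin
    k * R + suc (c * t + k * R) ≡⟨ collect k (c * t) (k * R) ⟩
    (k * R + k * R + c * t) + 1 ≤⟨ +-monoʳ-≤ (k * R + k * R + c * t) (≤-trans 1≤ct (m≤m+n _ _)) ⟩
    (k * R + k * R + c * t) + (c * t + (3 * c * t + k * c * t)) ≡⟨ merge k t ⟩
    D ∎
    where
    collect : ∀ k x y → y + (1 + (x + y)) ≡ (y + y + x) + 1
    collect = solve-∀
    merge : ∀ k t → k * (2 * (1 + k) * t) + k * (2 * (1 + k) * t) + (1 + k) * t
      + ((1 + k) * t + (3 * (1 + k) * t + k * (1 + k) * t)) ≡ 5 * (1 + k) * (1 + k) * t
    merge = solve-∀

  1≤D : 1 ≤ D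
  1≤D = ≤-trans (≤-trans (s≤s z≤n) (m≤n+m _ (k * R))) D-large′

  N-large : c + c * t ≤ N
  N-large = begin
    c + c * t ≤⟨ m≤m+n _ (c * t + 2 * t) ⟩
    c + c * t + (c * t + 2 * t) ≡⟨ collect c t ⟩
    (2 * t + (R + c)) * 1 ≤⟨ *-monoʳ-≤ (2 * t + (R + c)) 1≤D ⟩
    N ∎
    where
    collect : ∀ c t → c + c * t + (c * t + 2 * t) ≡ (2 * t + (2 * c * t + c)) * 1
    collect = solve-∀

  N-large′ : suc ((k * R + c * D) + (k * R + c * D)) ≤ N
  N-large′ = begin
    suc (x + x) ≤⟨ s≤s (+-monoʳ-≤ x (n≤1+n x)) ⟩
    suc x + suc x ≤⟨ +-mono-≤ half half ⟩
    (1 + c) * D + (1 + c) * D ≡⟨ sym (*-distribʳ-+ D (1 + c) (1 + c)) ⟩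
    ((1 + c) + (1 + c)) * D ≤⟨ *-monoˡ-≤ D factor ⟩
    N ∎
    where
    x = k * R + c * D
    1≤t : 1 ≤ t
    1≤t = ≤-trans (s≤s z≤n) (≤-trans 3≤k k≤t)
    rearrange : ∀ c → (1 + c) + (1 + c) ≡ 2 * 1 + (c * 1 + c)
    rearrange = solve-∀
    factor : (1 + c) + (1 + c) ≤ 2 * t + (R + c)
    factor = begin
      (1 + c) + (1 + c) ≡⟨ rearrange c ⟩
      2 * 1 + (c * 1 + c) ≤⟨ +-mono-≤ (*-monoʳ-≤ 2 1≤t) (+-monoˡ-≤ c (*-monoʳ-≤ c 1≤t)) ⟩
      2 * t + (c * t + c) ≤⟨ +-monoʳ-≤ (2 * t) (+-monoˡ-≤ c (*-monoˡ-≤ t (m≤m+n c (c + 0)))) ⟩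
      2 * t + (R + c) ∎
    half : suc x ≤ (1 + c) * D
    half = +-monoˡ-≤ (c * D) (≤-trans (s≤s (m≤m+n (k * R) _)) (≤-trans (≤-reflexive (sym (+-suc (k * R) _))) D-large′))

  N-small : N ≤ 6 * (1 + c) * (2 * c * c * t * (1 + t))
  N-small = begin
    (2 * t + (R + c)) * (5 * c * c * t) ≡⟨ collect c t ⟩
    (10 * (1 + c) * t + 5 * c) * (c * c * t)
      ≤⟨ *-monoˡ-≤ (c * c * t) (m≤m+n (10 * (1 + c) * t + 5 * c) (2 * (1 + c) * t + (7 * c + 12))) ⟩
    (10 * (1 + c) * t + 5 * c + (2 * (1 + c) * t + (7 * c + 12))) * (c * c * t) ≡⟨ merge c t ⟩
    6 * (1 + c) * (2 * c * c * t * (1 + t)) ∎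
    where
    collect : ∀ c t → (2 * t + (2 * c * t + c)) * (5 * c * c * t) ≡ (10 * (1 + c) * t + 5 * c) * (c * c * t)
    collect = solve-∀
    merge : ∀ c t → (10 * (1 + c) * t + 5 * c + (2 * (1 + c) * t + (7 * c + 12))) * (c * c * t) ≡
      6 * (1 + c) * (2 * c * c * t * (1 + t))
    merge = solve-∀

theorem1p2 : (r m : ℕ) → 5 ≤ r → 6 * r * ((4 * r) C (r ∸ 1)) < suc m →
    (χ : Colouring (suc m) (r ∸ 1)) → MonoHamBergeCycle m r (r ∸ 1) χ
theorem1p2 (suc (suc (suc (suc (suc q))))) m (s≤s (s≤s (s≤s (s≤s (s≤s z≤n))))) large χ =
  -- With r = 5 + q there are r - 1 = suc (3 + q) colours, and t = r + 2 = 7 + q.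
  Main.hamiltonian m (3 + q) (7 + q) (Bounds.B (3 + q) (7 + q) k≤t 3≤k) (Bounds.D (3 + q) (7 + q) k≤t 3≤k) χ
    (s≤s z≤n) 2≤m ≤-refl (≤-trans (s≤s N-large) N<) ≤-refl D-large D-large′ (≤-trans (s≤s N-large′) N<) N<
  where
  k≤t : 3 + q ≤ 7 + q
  k≤t = m≤n+m (3 + q) 4
  3≤k : 3 ≤ 3 + q
  3≤k = m≤m+n 3 q
  open Bounds (3 + q) (7 + q) k≤t 3≤k
  N< : N < suc m
  N< = ≤-trans (s≤s (≤-trans N-small (*-monoʳ-≤ (6 * (5 + q)) (C-lower q)))) large
  2≤m : 2 ≤ m
  2≤m = s≤s⁻¹ (≤-trans (s≤s (≤-trans (≤-trans (s≤s (s≤s z≤n)) (m≤m+n c (c * (7 + q)))) N-large)) N<)
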